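{- There is an absolute constant $C>0$ such that the following holds. Let $\mathbb{F}_q$ be a finite field, $n\ge1$ an integer, $d\ge1$ real, and let $A\subseteq\mathbb{F}_q^n$ satisfy $|A|\ge 2^{ -d}|\mathbb{F}_q^n|$. Then the number of triples $(x,y,z)\in A^3$ with $x+y=2z$ is at least $$q^{ -C d^{9}}\,|\mathbb{F}_q^n|^2.$$
   Context: Trivial solutions are included in the count. The constant $C$ does not depend on $q$, $n$, $d$ or $A$. -}

module Defs where

open import Algebra.Structures using (IsCommutativeRing)
open import Data.Fin.Base using (Fin)
import Data.Fin.Properties as Fin
open import Data.Integer.Base as ℤ using (ℤ; +_; -[1+_])
import Data.Integer.Properties as ℤ
open import Data.List.Base using (List; []; _∷_; map; filter; length; allFin; cartesianProduct; cartesianProductWith)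
open import Data.Nat.Base as ℕ using (ℕ; zero; suc)
import Data.Nat.Properties as ℕ
open import Data.Product using (∃; ∃-syntax; _×_; _,_; proj₁; proj₂)
open import Data.Rational.Base as ℚ using (ℚ; 0ℚ; 1ℚ; _⊔_; _⊓_; ↥_; ↧ₙ_)
open import Data.Rational.Literals using (fromℤ)
open import Data.Rational.Properties as ℚ using (module ≤-Reasoning)
open import Data.Sum.Base using (inj₁; inj₂)
open import Data.Vec.Base using (Vec; []; _∷_; zipWith)
import Data.Vec.Properties as Vec
open import Function.Bundles using (_↔_; module Inverse)
open import Function.Properties.Inverse using (↔⇒↣)
open import Level using (0ℓ)
open import Relation.Binary.Definitions using (DecidableEquality)
open import Relation.Binary.PropositionalEquality
open import Relation.Nullary using (¬_; yes; no; contradiction)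
open import Relation.Nullary.Decidable using (_×-dec_)
open import Relation.Unary using (Pred; Decidable)
open import Relation.Unary.Properties using (U?)
open import Algebra.Definitions.RawSemiring ℚ.+-*-rawSemiring using () renaming (_^_ to _^ℚ_)
open import Algebra.Bundles using (CommutativeRing)
import Algebra.Properties.Semiring.Exp as Exp

-- A real number x is the (one-sided, open) Dedekind cut L = { p ∈ ℚ : p < x }:
-- a non-empty proper initial segment of ℚ without largest element.
record ℝ : Set₁ where
  field
    L         : ℚ → Set
    inhabited : ∃ L
    proper    : ∃[ p ] ¬ L p
    lower     : ∀ {p q} → p ℚ.< q → L q → L p
    open′     : ∀ {p} → L p → ∃[ q ] (p ℚ.< q × L q)

open ℝ public using (L)

infix 4 _≤ℝ_ _<ℝ_

_≤ℝ_ : ℝ → ℝ → Set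
x ≤ℝ y = ∀ p → L x p → L y p

_<ℝ_ : ℝ → ℝ → Set
x <ℝ y = ∃[ p ] (¬ L x p × L y p)

private
  p-1<p : ∀ p → p ℚ.- 1ℚ ℚ.< p
  p-1<p p = subst (p ℚ.- 1ℚ ℚ.<_) (ℚ.+-identityʳ p) (ℚ.+-monoʳ-< p (ℚ.negative⁻¹ (ℚ.- 1ℚ)))

  below-bound : ∀ (x : ℝ) {p q} → L x p → ¬ L x q → p ℚ.≤ q
  below-bound x {p} {q} xp ¬xq with p ℚ.≤? q
  ... | yes p≤q = p≤q
  ... | no p≰q  = contradiction (ℝ.lower x (ℚ.≰⇒> p≰q) xp) ¬xq

fromℚ : ℚ → ℝ
fromℚ r = record
  { L         = ℚ._< r
  ; inhabited = r ℚ.- 1ℚ , p-1<p r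
  ; proper    = r , ℚ.<-irrefl refl
  ; lower     = ℚ.<-trans
  ; open′     = λ p<r → let q , p<q , q<r = ℚ.<-dense p<r in q , p<q , q<r
  }

fromℕ : ℕ → ℝ
fromℕ n = fromℚ (fromℤ (+ n))

infix 8 -ℝ_

-- p < - x iff x ≤ - s for some rational s > p, and x ≤ - s says that - s is not in the cut of x.
-ℝ_ : ℝ → ℝ
-ℝ x = record
  { L         = λ p → ∃[ s ] (p ℚ.< s × ¬ L x (ℚ.- s))
  ; inhabited = let q , ¬xq = ℝ.proper x in
                ℚ.- q ℚ.- 1ℚ , ℚ.- q , p-1<p (ℚ.- q) , subst (λ r → ¬ L x r) (sym (neg-neg q)) ¬xq
  ; proper    = let q , xq = ℝ.inhabited x in
                ℚ.- q , λ { (s , -q<s , ¬x-s) →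
                  ¬x-s (ℝ.lower x (subst (ℚ.- s ℚ.<_) (neg-neg q) (ℚ.neg-antimono-< -q<s)) xq) }
  ; lower     = λ { p<q (s , q<s , ¬x-s) → s , ℚ.<-trans p<q q<s , ¬x-s }
  ; open′     = λ { (s , p<s , ¬x-s) → let q , p<q , q<s = ℚ.<-dense p<s in q , p<q , s , q<s , ¬x-s }
  }
  where
  neg-neg : ∀ q → ℚ.- (ℚ.- q) ≡ q
  neg-neg (ℚ.mkℚ (+ zero)   _ _) = refl
  neg-neg (ℚ.mkℚ (+ suc _)  _ _) = refl
  neg-neg (ℚ.mkℚ (-[1+ _ ]) _ _) = refl

-- The product of two reals of arbitrary sign is the supremum of the minima of the product over
-- rational boxes [a , b] × [c , d] with a < x ≤ b and c < y ≤ d; such a minimum is attained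
-- at a corner.
BelowCorners : (p a b c d : ℚ) → Set
BelowCorners p a b c d = p ℚ.< a ℚ.* c × p ℚ.< a ℚ.* d × p ℚ.< b ℚ.* c × p ℚ.< b ℚ.* d

private
  below-endpoints : ∀ {p a b t} v → a ℚ.≤ t → t ℚ.≤ b → p ℚ.< a ℚ.* v → p ℚ.< b ℚ.* v → p ℚ.< t ℚ.* v
  below-endpoints v a≤t t≤b p<av p<bv with ℚ.≤-total 0ℚ v
  ... | inj₁ 0≤v = ℚ.<-≤-trans p<av (ℚ.*-monoʳ-≤-nonNeg v {{ℚ.nonNegative 0≤v}} a≤t)
  ... | inj₂ v≤0 = ℚ.<-≤-trans p<bv (ℚ.*-monoʳ-≤-nonPos v {{ℚ.nonPositive v≤0}} t≤b)

  below-box : ∀ {p a b c d t u} → a ℚ.≤ t → t ℚ.≤ b → c ℚ.≤ u → u ℚ.≤ d →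
              BelowCorners p a b c d → p ℚ.< t ℚ.* u
  below-box {p} {a} {b} {c} {d} {t} {u} a≤t t≤b c≤u u≤d (ac , ad , bc , bd) =
    below-endpoints u a≤t t≤b (second a ac ad) (second b bc bd)
    where
    second : ∀ e → p ℚ.< e ℚ.* c → p ℚ.< e ℚ.* d → p ℚ.< e ℚ.* u
    second e ec ed = subst (p ℚ.<_) (ℚ.*-comm u e)
      (below-endpoints e c≤u u≤d (subst (p ℚ.<_) (ℚ.*-comm e c) ec) (subst (p ℚ.<_) (ℚ.*-comm e d) ed))

  above-endpoints : ∀ {p a b t} v → a ℚ.≤ t → t ℚ.≤ b → a ℚ.* v ℚ.≤ p → b ℚ.* v ℚ.≤ p → t ℚ.* v ℚ.≤ p
  above-endpoints v a≤t t≤b av≤p bv≤p with ℚ.≤-total 0ℚ v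
  ... | inj₁ 0≤v = ℚ.≤-trans (ℚ.*-monoʳ-≤-nonNeg v {{ℚ.nonNegative 0≤v}} t≤b) bv≤p
  ... | inj₂ v≤0 = ℚ.≤-trans (ℚ.*-monoʳ-≤-nonPos v {{ℚ.nonPositive v≤0}} a≤t) av≤p

  above-box : ∀ {p a b c d t u} → a ℚ.≤ t → t ℚ.≤ b → c ℚ.≤ u → u ℚ.≤ d →
              a ℚ.* c ℚ.≤ p → a ℚ.* d ℚ.≤ p → b ℚ.* c ℚ.≤ p → b ℚ.* d ℚ.≤ p → t ℚ.* u ℚ.≤ p
  above-box {p} {a} {b} {c} {d} {t} {u} a≤t t≤b c≤u u≤d ac ad bc bd =
    above-endpoints u a≤t t≤b (second a ac ad) (second b bc bd)
    where
    second : ∀ e → e ℚ.* c ℚ.≤ p → e ℚ.* d ℚ.≤ p → e ℚ.* u ℚ.≤ p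
    second e ec ed = subst (ℚ._≤ p) (ℚ.*-comm u e)
      (above-endpoints e c≤u u≤d (subst (ℚ._≤ p) (ℚ.*-comm e c) ec) (subst (ℚ._≤ p) (ℚ.*-comm e d) ed))

  min-corner : ∀ a b c d → ∃[ m ] (∀ p → p ℚ.< m → BelowCorners p a b c d)
  min-corner a b c d = (ac ⊓ ad) ⊓ (bc ⊓ bd) , λ p p<m →
      ℚ.<-≤-trans p<m (ℚ.≤-trans (ℚ.p⊓q≤p _ _) (ℚ.p⊓q≤p ac ad))
    , ℚ.<-≤-trans p<m (ℚ.≤-trans (ℚ.p⊓q≤p _ _) (ℚ.p⊓q≤q ac ad))
    , ℚ.<-≤-trans p<m (ℚ.≤-trans (ℚ.p⊓q≤q (ac ⊓ ad) _) (ℚ.p⊓q≤p bc bd))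
    , ℚ.<-≤-trans p<m (ℚ.≤-trans (ℚ.p⊓q≤q (ac ⊓ ad) _) (ℚ.p⊓q≤q bc bd))
    where
    ac = a ℚ.* c
    ad = a ℚ.* d
    bc = b ℚ.* c
    bd = b ℚ.* d

  dense₂ : ∀ {p u v} → p ℚ.< u → p ℚ.< v → ∃[ q ] (p ℚ.< q × q ℚ.< u × q ℚ.< v)
  dense₂ {p} {u} {v} p<u p<v with ℚ.≤-total u v
  ... | inj₁ u≤v = let q , p<q , q<u = ℚ.<-dense p<u in q , p<q , q<u , ℚ.<-≤-trans q<u u≤v
  ... | inj₂ v≤u = let q , p<q , q<v = ℚ.<-dense p<v in q , p<q , ℚ.<-≤-trans q<v v≤u , q<v

  ⊔-in : ∀ (x : ℝ) {p q} → L x p → L x q → L x (p ⊔ q)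
  ⊔-in x {p} {q} xp xq with ℚ.⊔-sel p q
  ... | inj₁ eq = subst (L x) (sym eq) xp
  ... | inj₂ eq = subst (L x) (sym eq) xq

infixl 7 _*ℝ_

_*ℝ_ : ℝ → ℝ → ℝ
x *ℝ y = record
  { L         = Lxy
  ; inhabited = let m , below = min-corner a₀ b₀ c₀ d₀ in
                m ℚ.- 1ℚ , a₀ , b₀ , c₀ , d₀ , xa₀ , ¬xb₀ , yc₀ , ¬yd₀ , below _ (p-1<p m)
  ; proper    = M , not-below
  ; lower     = λ { p<q (a , b , c , d , xa , ¬xb , yc , ¬yd , ac , ad , bc , bd) →
                  a , b , c , d , xa , ¬xb , yc , ¬yd ,
                  ℚ.<-trans p<q ac , ℚ.<-trans p<q ad , ℚ.<-trans p<q bc , ℚ.<-trans p<q bd }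
  ; open′     = λ { (a , b , c , d , xa , ¬xb , yc , ¬yd , ac , ad , bc , bd) →
                  let q₁ , p<q₁ , q₁<ac , q₁<ad = dense₂ ac ad
                      q₂ , p<q₂ , q₂<bc , q₂<bd = dense₂ bc bd
                      q , p<q , q<q₁ , q<q₂ = dense₂ p<q₁ p<q₂
                  in q , p<q , a , b , c , d , xa , ¬xb , yc , ¬yd ,
                     ℚ.<-trans q<q₁ q₁<ac , ℚ.<-trans q<q₁ q₁<ad ,
                     ℚ.<-trans q<q₂ q₂<bc , ℚ.<-trans q<q₂ q₂<bd }
  }
  where
  Lxy : ℚ → Set
  Lxy p = ∃[ a ] ∃[ b ] ∃[ c ] ∃[ d ] (L x a × ¬ L x b × L y c × ¬ L y d × BelowCorners p a b c d)

  a₀ = proj₁ (ℝ.inhabited x)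
  b₀ = proj₁ (ℝ.proper x)
  c₀ = proj₁ (ℝ.inhabited y)
  d₀ = proj₁ (ℝ.proper y)
  xa₀ = proj₂ (ℝ.inhabited x)
  ¬xb₀ = proj₂ (ℝ.proper x)
  yc₀ = proj₂ (ℝ.inhabited y)
  ¬yd₀ = proj₂ (ℝ.proper y)

  M : ℚ
  M = (a₀ ℚ.* c₀ ⊔ a₀ ℚ.* d₀) ⊔ (b₀ ℚ.* c₀ ⊔ b₀ ℚ.* d₀)

  not-below : ¬ Lxy M
  not-below (a , b , c , d , xa , ¬xb , yc , ¬yd , corners) = ℚ.<-irrefl refl (ℚ.<-≤-trans
    (below-box (ℚ.p≤p⊔q a a₀) (below-bound x xt ¬xb) (ℚ.p≤p⊔q c c₀) (below-bound y yu ¬yd) corners)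
    (above-box (ℚ.p≤q⊔p a a₀) (below-bound x xt ¬xb₀) (ℚ.p≤q⊔p c c₀) (below-bound y yu ¬yd₀)
      (ℚ.≤-trans (ℚ.p≤p⊔q (a₀ ℚ.* c₀) _) (ℚ.p≤p⊔q _ _))
      (ℚ.≤-trans (ℚ.p≤q⊔p (a₀ ℚ.* c₀) _) (ℚ.p≤p⊔q _ _))
      (ℚ.≤-trans (ℚ.p≤p⊔q (b₀ ℚ.* c₀) _) (ℚ.p≤q⊔p (a₀ ℚ.* c₀ ⊔ a₀ ℚ.* d₀) _))
      (ℚ.≤-trans (ℚ.p≤q⊔p (b₀ ℚ.* c₀) _) (ℚ.p≤q⊔p (a₀ ℚ.* c₀ ⊔ a₀ ℚ.* d₀) _))))
    where
    xt : L x (a ⊔ a₀)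
    xt = ⊔-in x xa xa₀
    yu : L y (c ⊔ c₀)
    yu = ⊔-in y yc yc₀

infixr 8 _^ⁿ_ _^ℝ_

_^ⁿ_ : ℝ → ℕ → ℝ
x ^ⁿ zero  = fromℕ 1
x ^ⁿ suc k = x *ℝ x ^ⁿ k

-- RootBound b m k s says s ≤ b ^ (m / k), for s ≥ 0 and k ≥ 1, in the form s ^ k ≤ b ^ m.
RootBound : ℕ → ℤ → ℕ → ℚ → Set
RootBound b (+ m)    k s = s ^ℚ k ℚ.≤ fromℤ (+ b) ^ℚ m
RootBound b -[1+ m ] k s = s ^ℚ k ℚ.* fromℤ (+ b) ^ℚ suc m ℚ.≤ 1ℚ

private
  module ℚ^ = Exp (CommutativeRing.semiring ℚ.+-*-commutativeRing)

  1≤fromℤ : ∀ b .{{_ : ℕ.NonZero b}} → 1ℚ ℚ.≤ fromℤ (+ b)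
  1≤fromℤ (suc b) = ℚ.*≤* (ℤ.+≤+ (ℕ.s≤s ℕ.z≤n))

  0≤1 : 0ℚ ℚ.≤ 1ℚ
  0≤1 = ℚ.nonNegative⁻¹ 1ℚ

  *-mono-≤ : ∀ {p q r s} → 0ℚ ℚ.≤ p → 0ℚ ℚ.≤ s → p ℚ.≤ q → r ℚ.≤ s → p ℚ.* r ℚ.≤ q ℚ.* s
  *-mono-≤ {p} {q} {r} {s} 0≤p 0≤s p≤q r≤s = ℚ.≤-trans
    (ℚ.*-monoˡ-≤-nonNeg p {{ℚ.nonNegative 0≤p}} r≤s)
    (ℚ.*-monoʳ-≤-nonNeg s {{ℚ.nonNegative 0≤s}} p≤q)

  1≤* : ∀ {p q} → 1ℚ ℚ.≤ p → 1ℚ ℚ.≤ q → 1ℚ ℚ.≤ p ℚ.* q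
  1≤* {p} {q} 1≤p 1≤q = *-mono-≤ {1ℚ} {p} {1ℚ} {q} 0≤1 (ℚ.≤-trans 0≤1 1≤q) 1≤p 1≤q

  1≤^ : ∀ {p} k → 1ℚ ℚ.≤ p → 1ℚ ℚ.≤ p ^ℚ k
  1≤^ zero    1≤p = ℚ.≤-refl
  1≤^ (suc k) 1≤p = 1≤* 1≤p (1≤^ k 1≤p)

  ^-mono-exp : ∀ {p m n} → 1ℚ ℚ.≤ p → m ℕ.≤ n → p ^ℚ m ℚ.≤ p ^ℚ n
  ^-mono-exp {n = n} 1≤p ℕ.z≤n = 1≤^ n 1≤p
  ^-mono-exp {p} 1≤p (ℕ.s≤s m≤n) =
    ℚ.*-monoˡ-≤-nonNeg p {{ℚ.nonNegative (ℚ.≤-trans 0≤1 1≤p)}} (^-mono-exp 1≤p m≤n)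

  ^-mono-base : ∀ {p q} k → 1ℚ ℚ.≤ p → p ℚ.≤ q → p ^ℚ k ℚ.≤ q ^ℚ k
  ^-mono-base zero    1≤p p≤q = ℚ.≤-refl
  ^-mono-base (suc k) 1≤p p≤q = *-mono-≤ (ℚ.≤-trans 0≤1 1≤p)
    (ℚ.≤-trans 0≤1 (1≤^ k (ℚ.≤-trans 1≤p p≤q))) p≤q (^-mono-base k 1≤p p≤q)

  ^-mono-base-< : ∀ {p q} k → 1ℚ ℚ.≤ p → p ℚ.< q → p ^ℚ suc k ℚ.< q ^ℚ suc k
  ^-mono-base-< {p} {q} k 1≤p p<q = ℚ.<-≤-trans
    (ℚ.*-monoˡ-<-pos (p ^ℚ k) {{ℚ.positive (ℚ.<-≤-trans (ℚ.positive⁻¹ 1ℚ) (1≤^ k 1≤p))}} p<q)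
    (ℚ.*-monoˡ-≤-nonNeg q {{ℚ.nonNegative (ℚ.≤-trans 0≤1 (ℚ.≤-trans 1≤p (ℚ.<⇒≤ p<q)))}}
      (^-mono-base k 1≤p (ℚ.<⇒≤ p<q)))

  -- m / k < N implies m ≤ ∣ ↥ N ∣ k
  numerator-bound : ∀ N m k .{{_ : ℕ.NonZero k}} d → + m ℤ.* + suc d ℤ.< N ℤ.* + k → m ℕ.≤ ℤ.∣ N ∣ ℕ.* k
  numerator-bound (+ n) m k d m<n rewrite sym (ℤ.pos-* m (suc d)) | sym (ℤ.pos-* n k) =
    ℕ.≤-trans (ℕ.m≤m*n m (suc d)) (ℕ.<⇒≤ (ℤ.drop‿+<+ m<n))
  numerator-bound -[1+ n ] m (suc k) d m<n rewrite sym (ℤ.pos-* m (suc d)) = contradiction m<n λ ()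

  root-bound : ∀ b .{{_ : ℕ.NonZero b}} N t {s} → t ℚ.< N →
               fromℤ (+ b) ^ℚ ℤ.∣ ↥ N ∣ ℚ.< s → ¬ RootBound b (↥ t) (↧ₙ t) s
  root-bound b N t@(ℚ.mkℚ (+ m) k-1 _) {s} t<N B<s s^k≤b^m = ℚ.<-irrefl refl (begin-strict
    (β ^ℚ n) ^ℚ suc k-1    <⟨ ^-mono-base-< k-1 (1≤^ n (1≤fromℤ b)) B<s ⟩
    s ^ℚ suc k-1           ≤⟨ s^k≤b^m ⟩
    β ^ℚ m                 ≤⟨ ^-mono-exp (1≤fromℤ b) (numerator-bound (↥ N) m (suc k-1) _ (ℚ.drop-*<* t<N)) ⟩
    β ^ℚ (n ℕ.* suc k-1)   ≡⟨ ℚ^.^-assocʳ β n (suc k-1) ⟨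
    (β ^ℚ n) ^ℚ suc k-1    ∎)
    where
    open ≤-Reasoning
    β = fromℤ (+ b)
    n = ℤ.∣ ↥ N ∣
  root-bound b N (ℚ.mkℚ -[1+ m ] k-1 _) {s} t<N B<s s^k*b≤1 = ℚ.<-irrefl refl (begin-strict
    1ℚ                                   ≤⟨ 1≤^ (suc k-1) 1≤B ⟩
    B ^ℚ suc k-1                         <⟨ ^-mono-base-< k-1 1≤B B<s ⟩
    s ^ℚ suc k-1                         ≡⟨ ℚ.*-identityʳ _ ⟨
    s ^ℚ suc k-1 ℚ.* 1ℚ                  ≤⟨ *-mono-≤ 0≤s^k (ℚ.≤-trans 0≤1 1≤b^m) ℚ.≤-refl 1≤b^m ⟩
    s ^ℚ suc k-1 ℚ.* fromℤ (+ b) ^ℚ suc m ≤⟨ s^k*b≤1 ⟩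
    1ℚ                                   ∎)
    where
    open ≤-Reasoning
    B = fromℤ (+ b) ^ℚ ℤ.∣ ↥ N ∣
    1≤B : 1ℚ ℚ.≤ B
    1≤B = 1≤^ ℤ.∣ ↥ N ∣ (1≤fromℤ b)
    1≤b^m = 1≤^ (suc m) (1≤fromℤ b)
    0≤s^k = ℚ.≤-trans 0≤1 (1≤^ (suc k-1) (ℚ.≤-trans 1≤B (ℚ.<⇒≤ B<s)))

  0-root-bound : ∀ b .{{_ : ℕ.NonZero b}} m k → RootBound b m (suc k) 0ℚ
  0-root-bound b (+ m)    k = subst (ℚ._≤ fromℤ (+ b) ^ℚ m) (sym (ℚ.*-zeroˡ (0ℚ ^ℚ k)))
    (ℚ.≤-trans 0≤1 (1≤^ m (1≤fromℤ b)))
  0-root-bound b -[1+ m ] k = subst (ℚ._≤ 1ℚ) (sym (trans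
      (cong (ℚ._* fromℤ (+ b) ^ℚ suc m) (ℚ.*-zeroˡ (0ℚ ^ℚ k)))
      (ℚ.*-zeroˡ (fromℤ (+ b) ^ℚ suc m))))
    0≤1

-- b ^ x = sup { b ^ t : t ∈ ℚ, t < x } (b ≥ 1), with b ^ t = sup { s ∈ ℚ : 0 ≤ s, s ≤ b ^ t }.
_^ℝ_ : (b : ℕ) .{{_ : ℕ.NonZero b}} → ℝ → ℝ
b ^ℝ x = record
  { L         = λ p → ∃[ t ] ∃[ s ] (L x t × 0ℚ ℚ.≤ s × RootBound b (↥ t) (↧ₙ t) s × p ℚ.< s)
  ; inhabited = let t , xt = ℝ.inhabited x in
                0ℚ ℚ.- 1ℚ , t , 0ℚ , xt , ℚ.≤-refl , 0-root-bound b (↥ t) _ , p-1<p 0ℚ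
  ; proper    = let N , ¬xN = ℝ.proper x in
                fromℤ (+ b) ^ℚ ℤ.∣ ↥ N ∣ ,
                λ { (t , s , xt , _ , s≤b^t , B<s) → root-bound b N t (below-< xt ¬xN) B<s s≤b^t }
  ; lower     = λ { p<q (t , s , xt , 0≤s , s≤b^t , q<s) → t , s , xt , 0≤s , s≤b^t , ℚ.<-trans p<q q<s }
  ; open′     = λ { (t , s , xt , 0≤s , s≤b^t , p<s) →
                  let q , p<q , q<s = ℚ.<-dense p<s in q , p<q , t , s , xt , 0≤s , s≤b^t , q<s }
  }
  where
  below-< : ∀ {p q} → L x p → ¬ L x q → p ℚ.< q
  below-< xp ¬xq = let p′ , p<p′ , xp′ = ℝ.open′ x xp in ℚ.<-≤-trans p<p′ (below-bound x xp′ ¬xq)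

record FiniteField : Set₁ where
  infixl 6 _+_
  infixl 7 _*_
  field
    Carrier           : Set
    _+_ _*_           : Carrier → Carrier → Carrier
    -_                : Carrier → Carrier
    0# 1#             : Carrier
    isCommutativeRing : IsCommutativeRing _≡_ _+_ _*_ -_ 0# 1#
    0≢1               : 0# ≢ 1#
    inverse           : ∀ x → x ≢ 0# → ∃[ y ] x * y ≡ 1#
    order             : ℕ
    enumeration       : Carrier ↔ Fin order

  elements : List Carrier
  elements = map (Inverse.from enumeration) (allFin order)

  _≟_ : DecidableEquality Carrier
  _≟_ = Fin.inj⇒≟ (↔⇒↣ enumeration)

  instance
    order-nonZero : ℕ.NonZero order
    order-nonZero = Fin.nonZeroIndex (Inverse.to enumeration 0#)

module _ (𝔽 : FiniteField) where
  open FiniteField 𝔽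

  Space : ℕ → Set
  Space = Vec Carrier

  vectors : ∀ n → List (Space n)
  vectors zero    = [] ∷ []
  vectors (suc n) = cartesianProductWith _∷_ elements (vectors n)

  card : ∀ {n} {A : Pred (Space n) 0ℓ} → Decidable A → ℕ
  card {n} A? = length (filter A? (vectors n))

  ∣𝔽^_∣ : ℕ → ℕ
  ∣𝔽^ n ∣ = card {n} U?

  _⊕_ : ∀ {n} → Space n → Space n → Space n
  _⊕_ = zipWith _+_

  Solution : ∀ {n} → Pred (Space n) 0ℓ → Pred (Space n × Space n × Space n) 0ℓ
  Solution A (x , y , z) = (A x × A y × A z) × x ⊕ y ≡ z ⊕ z

  solution? : ∀ {n} {A : Pred (Space n) 0ℓ} → Decidable A → Decidable (Solution A)
  solution? A? (x , y , z) = (A? x ×-dec A? y ×-dec A? z) ×-dec Vec.≡-dec _≟_ (x ⊕ y) (z ⊕ z)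

  #solutions : ∀ {n} {A : Pred (Space n) 0ℓ} → Decidable A → ℕ
  #solutions {n} A? =
    length (filter (solution? A?) (cartesianProduct (vectors n) (cartesianProduct (vectors n) (vectors n))))

{-# OPTIONS --safe #-}

-- If B ⊆ F_q^m contains no x, y, z with x + y = 2z and x ≠ z, then
-- ∏ᵢ ∏_{c ≠ 0} (c + xᵢ + yᵢ − 2zᵢ) is a diagonal tensor on B with non-zero diagonal. It has degree
-- m (q − 1), so Tao's slice rank argument gives ∣B∣ ≤ 3 l, where l counts the monomials of degree at most
-- m (q − 1) / 3 with exponents below q; Chernoff's method gives l ≤ (139 q / 140)^m, uniformly in q.
-- Hence in dimension m ≈ 140 E every set of density well above 2^(−E) contains a progression with
-- x ≠ z. Pulling A back along all affine maps F_q^m → F_q^n, most of the density of A is carried by maps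
-- that see such a progression, while each fixed pair x ≠ z has an equidistributed image; this bounds
-- the number of solutions in A below by q^(−2m − E − 1) q^(2n), with an exponent that is even linear in d.
module Submission where

open import Algebra.Structures using (IsCommutativeSemiring; IsCommutativeRing)
open import Algebra.Bundles using (CommutativeRing)
import Algebra.Properties.Ring as RingProperties
import Algebra.Solver.Ring.NaturalCoefficients.Default as NaturalCoefficients
open import Data.Empty using (⊥)
open import Data.Fin.Base as Fin using (Fin)
import Data.Integer.Base as ℤ
import Data.Integer.Properties as ℤ
open import Data.List.Base as List using (List; []; _∷_; _++_; length; filter; allFin; cartesianProduct; cartesianProductWith; upTo)
import Data.List.Properties as List
open import Data.List.Membership.Propositional using (_∈_; find; lose)
open import Data.List.Membership.Propositional.Properties
open import Data.List.Relation.Binary.Permutation.Propositional using (_↭_; ↭-sym; ↭⇒↭ₛ)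
import Data.List.Relation.Binary.Permutation.Propositional.Properties as ↭
import Data.List.Relation.Binary.Permutation.Setoid.Properties as ↭ₛ
open import Data.List.Relation.Unary.All as All using (All; []; _∷_)
import Data.List.Relation.Unary.All.Properties as All
import Data.List.Relation.Unary.AllPairs as AllPairs
open import Data.List.Relation.Unary.Any using (any?; here; there)
open import Data.List.Relation.Unary.Unique.Propositional using (Unique; []; _∷_)
import Data.List.Relation.Unary.Unique.Propositional.Properties as Unique
open import Data.Nat.Base as ℕ using (ℕ; zero; suc; z≤n; s≤s; s≤s⁻¹; NonZero; _≤_; _<_; _∸_; _^_)
import Data.Nat.Properties as ℕ
import Data.Nat.Tactic.RingSolver as ℕ
open import Data.Product using (Σ; ∃; _×_; _,_; proj₁; proj₂)
open import Data.Rational.Base as ℚ using (ℚ; 0ℚ; 1ℚ; ½; ↥_; ↧ₙ_)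
open import Data.Rational.Literals using (fromℤ)
import Data.Rational.Properties as ℚ
import Data.Rational.Unnormalised.Base as ℚᵘ
import Data.Rational.Unnormalised.Properties as ℚᵘ
open import Data.Sum.Base using (_⊎_; inj₁; inj₂)
open import Data.Vec.Base as Vec using (Vec; []; _∷_; zipWith)
import Data.Vec.Properties as Vec
open import Data.Vec.Relation.Unary.All as VAll using ([]; _∷_) renaming (All to VAll)
open import Function.Base using (_∘_; id)
open import Function.Bundles using (Inverse)
open import Level using (0ℓ)
open import Relation.Binary.Definitions using (DecidableEquality)
open import Relation.Binary.PropositionalEquality
open import Relation.Nullary using (¬_; Dec; yes; no; contradiction)
open import Relation.Nullary.Decidable using (_×-dec_; ¬?; decidable-stable)
open import Relation.Unary using (Pred; Decidable)
open import Relation.Unary.Properties using (U?)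
open import Defs

-- The slice rank bound alone yields one progression in a dense set; a count needs it in a dimension
-- that does not grow with n. Since the factor saved per coordinate depends neither on q nor on n, a
-- dimension m of order d suffices, and the loss q^(2m), one unit for each pair of points of F_q^m,
-- is affordable. Then the images of two distinct points are exactly uniform on pairs, and a
-- progression that collapses is a trivial solution, which the count includes. Requiring x ≠ z
-- rather than x ≠ y makes characteristic 2 fit without a case distinction: there 2z = 0 and the
-- solutions are the triples with x = y. Chernoff's method is uniform in q because an exponent
-- uniform on 0, ..., q - 1 has mean (q - 1)/2, above the threshold (q - 1)/3 by a fixed proportion;
-- the parameter t = 1 - 1/(36 (q - 1)) approaches 1 at the matching rate. The combinatorics stays
-- in ℕ with denominators cleared. Real numbers enter only at the end, where d is replaced by a
-- natural number D with D/2 < d ≤ D.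

-- Vectors with entries from a list

tuples : {X : Set} → List X → ∀ m → List (Vec X m)
tuples xs zero    = [] ∷ []
tuples xs (suc m) = cartesianProductWith _∷_ xs (tuples xs m)

∈-tuples⁺ : {X : Set} {xs : List X} {m : ℕ} {v : Vec X m} → VAll (_∈ xs) v → v ∈ tuples xs m
∈-tuples⁺ []       = here refl
∈-tuples⁺ (p ∷ ps) = ∈-cartesianProductWith⁺ _∷_ p (∈-tuples⁺ ps)

∈-tuples⁻ : {X : Set} (xs : List X) (m : ℕ) {v : Vec X m} → v ∈ tuples xs m → VAll (_∈ xs) v
∈-tuples⁻ xs zero    (here refl) = []
∈-tuples⁻ xs (suc m) v∈ with ∈-cartesianProductWith⁻ _∷_ xs (tuples xs m) v∈
... | _ , _ , x∈ , w∈ , refl = x∈ ∷ ∈-tuples⁻ xs m w∈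

tuples-unique : {X : Set} {xs : List X} (m : ℕ) → Unique xs → Unique (tuples xs m)
tuples-unique zero    u = [] ∷ []
tuples-unique (suc m) u = Unique.cartesianProductWith⁺ _∷_ Vec.∷-injective u (tuples-unique m u)

-- Finite sums and products in a commutative semiring

module ListSum (R : Set) (_+_ _*_ : R → R → R) (0# 1# : R)
               (isCommutativeSemiring : IsCommutativeSemiring _≡_ _+_ _*_ 0# 1#) where

  open IsCommutativeSemiring isCommutativeSemiring
    using (+-assoc; +-comm; +-identityˡ; +-identityʳ; *-assoc; *-comm; *-identityˡ; distribˡ; zeroˡ; zeroʳ)
  open ≡-Reasoning

  ∑ : {I : Set} → List I → (I → R) → R
  ∑ []       f = 0#
  ∑ (x ∷ xs) f = f x + ∑ xs f

  ∏ : ∀ {m} → Vec R m → R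
  ∏ []       = 1#
  ∏ (x ∷ xs) = x * ∏ xs

  ∑-cong : {I : Set} {f g : I → R} (xs : List I) → (∀ {x} → x ∈ xs → f x ≡ g x) → ∑ xs f ≡ ∑ xs g
  ∑-cong []       f≡g = refl
  ∑-cong (x ∷ xs) f≡g = cong₂ _+_ (f≡g (here refl)) (∑-cong xs (f≡g ∘ there))

  ∑-zero : {I : Set} {f : I → R} (xs : List I) → (∀ {x} → x ∈ xs → f x ≡ 0#) → ∑ xs f ≡ 0#
  ∑-zero []       f≡0 = refl
  ∑-zero (x ∷ xs) f≡0 = trans (cong₂ _+_ (f≡0 (here refl)) (∑-zero xs (f≡0 ∘ there))) (+-identityˡ 0#)

  +-interchange : ∀ a b c d → (a + b) + (c + d) ≡ (a + c) + (b + d)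
  +-interchange a b c d = begin
    (a + b) + (c + d)  ≡⟨ +-assoc a b (c + d) ⟩
    a + (b + (c + d))  ≡⟨ cong (a +_) (+-assoc b c d) ⟨
    a + ((b + c) + d)  ≡⟨ cong (λ s → a + (s + d)) (+-comm b c) ⟩
    a + ((c + b) + d)  ≡⟨ cong (a +_) (+-assoc c b d) ⟩
    a + (c + (b + d))  ≡⟨ +-assoc a c (b + d) ⟨
    (a + c) + (b + d)  ∎

  ∑-distrib-+ : {I : Set} (xs : List I) (f g : I → R) → ∑ xs (λ x → f x + g x) ≡ ∑ xs f + ∑ xs g
  ∑-distrib-+ []       f g = sym (+-identityˡ 0#)
  ∑-distrib-+ (x ∷ xs) f g = trans (cong (_ +_) (∑-distrib-+ xs f g)) (+-interchange _ _ _ _)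

  *-distribˡ-∑ : {I : Set} (c : R) (xs : List I) (f : I → R) → c * ∑ xs f ≡ ∑ xs (λ x → c * f x)
  *-distribˡ-∑ c []       f = zeroʳ c
  *-distribˡ-∑ c (x ∷ xs) f = trans (distribˡ c _ _) (cong (_ +_) (*-distribˡ-∑ c xs f))

  *-distribʳ-∑ : {I : Set} (c : R) (xs : List I) (f : I → R) → ∑ xs f * c ≡ ∑ xs (λ x → f x * c)
  *-distribʳ-∑ c xs f =
    trans (*-comm _ c) (trans (*-distribˡ-∑ c xs f) (∑-cong xs λ _ → *-comm c _))

  ∑-comm : {I J : Set} (xs : List I) (ys : List J) (f : I → J → R) →
           ∑ xs (λ x → ∑ ys (f x)) ≡ ∑ ys (λ y → ∑ xs (λ x → f x y))
  ∑-comm []       ys f = sym (∑-zero ys λ _ → refl)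
  ∑-comm (x ∷ xs) ys f =
    trans (cong (∑ ys (f x) +_) (∑-comm xs ys f)) (sym (∑-distrib-+ ys (f x) _))

  ∑-++ : {I : Set} (xs ys : List I) (f : I → R) → ∑ (xs ++ ys) f ≡ ∑ xs f + ∑ ys f
  ∑-++ []       ys f = sym (+-identityˡ _)
  ∑-++ (x ∷ xs) ys f = trans (cong (f x +_) (∑-++ xs ys f)) (sym (+-assoc _ _ _))

  ∑-map : {I J : Set} (g : I → J) (xs : List I) (f : J → R) → ∑ (List.map g xs) f ≡ ∑ xs (f ∘ g)
  ∑-map g []       f = refl
  ∑-map g (x ∷ xs) f = cong (f (g x) +_) (∑-map g xs f)

  ∑-cartesianProductWith : {I J K : Set} (g : I → J → K) (xs : List I) (ys : List J) (f : K → R) →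
    ∑ (cartesianProductWith g xs ys) f ≡ ∑ xs (λ x → ∑ ys (λ y → f (g x y)))
  ∑-cartesianProductWith g []       ys f = refl
  ∑-cartesianProductWith g (x ∷ xs) ys f = trans (∑-++ (List.map (g x) ys) _ f)
    (cong₂ _+_ (∑-map (g x) ys f) (∑-cartesianProductWith g xs ys f))

  ∑-single : {I : Set} {xs : List I} {f : I → R} {a : I} → Unique xs → a ∈ xs →
             (∀ {x} → x ∈ xs → x ≢ a → f x ≡ 0#) → ∑ xs f ≡ f a
  ∑-single {xs = x ∷ xs} (x∉ ∷ u) (here refl) f≡0 = trans
    (cong (_ +_) (∑-zero xs λ y∈ → f≡0 (there y∈) λ { refl → All.lookup x∉ y∈ refl })) (+-identityʳ _)
  ∑-single {xs = x ∷ xs} (x∉ ∷ u) (there a∈) f≡0 = trans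
    (cong₂ _+_ (f≡0 (here refl) λ { refl → All.lookup x∉ a∈ refl }) (∑-single u a∈ (f≡0 ∘ there)))
    (+-identityˡ _)

  𝟙 : {P : Set} → Dec P → R
  𝟙 (yes _) = 1#
  𝟙 (no _)  = 0#

  ∑-indicator : {I : Set} (_≟_ : DecidableEquality I) {xs : List I} → Unique xs → ∀ {a} → a ∈ xs →
                (f : I → R) → ∑ xs (λ x → 𝟙 (a ≟ x) * f x) ≡ f a
  ∑-indicator _≟_ {xs} u {a} a∈ f = trans (∑-single u a∈ off) at-a
    where
    off : ∀ {x} → x ∈ xs → x ≢ a → 𝟙 (a ≟ x) * f x ≡ 0#
    off {x} _ x≢a with a ≟ x
    ... | yes refl = contradiction refl x≢a
    ... | no _     = zeroˡ _
    at-a : 𝟙 (a ≟ a) * f a ≡ f a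
    at-a with a ≟ a
    ... | yes _  = *-identityˡ _
    ... | no a≢a = contradiction refl a≢a

  *-interchange : ∀ a b c d → (a * b) * (c * d) ≡ (a * c) * (b * d)
  *-interchange a b c d = begin
    (a * b) * (c * d)  ≡⟨ *-assoc a b (c * d) ⟩
    a * (b * (c * d))  ≡⟨ cong (a *_) (*-assoc b c d) ⟨
    a * ((b * c) * d)  ≡⟨ cong (λ s → a * (s * d)) (*-comm b c) ⟩
    a * ((c * b) * d)  ≡⟨ cong (a *_) (*-assoc c b d) ⟩
    a * (c * (b * d))  ≡⟨ *-assoc a c (b * d) ⟨
    (a * c) * (b * d)  ∎

  ∑-*-∑ : {I J : Set} (xs : List I) (ys : List J) (f : I → R) (g : J → R) →
          ∑ xs (λ x → ∑ ys (λ y → f x * g y)) ≡ ∑ xs f * ∑ ys g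
  ∑-*-∑ xs ys f g = trans (∑-cong xs λ _ → sym (*-distribˡ-∑ _ ys g)) (sym (*-distribʳ-∑ _ xs f))

  -- Multiplying out a product of `m` sums means choosing one summand in each factor; the choices
  -- are the vectors `τ`.
  ∑-∏ : {I Y : Set} (ts : List I) (g : I → Y → R) {m : ℕ} (ys : Vec Y m) →
        ∑ (tuples ts m) (λ τ → ∏ (zipWith g τ ys)) ≡ ∏ (Vec.map (λ y → ∑ ts (λ t → g t y)) ys)
  ∑-∏ ts g []       = +-identityʳ 1#
  ∑-∏ ts g {suc m} (y ∷ ys) = begin
    ∑ (cartesianProductWith _∷_ ts (tuples ts m)) (λ τ → ∏ (zipWith g τ (y ∷ ys)))
      ≡⟨ ∑-cartesianProductWith _∷_ ts (tuples ts m) _ ⟩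
    ∑ ts (λ t → ∑ (tuples ts m) (λ τ → g t y * ∏ (zipWith g τ ys)))
      ≡⟨ ∑-*-∑ ts (tuples ts m) (λ t → g t y) _ ⟩
    ∑ ts (λ t → g t y) * ∑ (tuples ts m) (λ τ → ∏ (zipWith g τ ys))
      ≡⟨ cong (_ *_) (∑-∏ ts g ys) ⟩
    ∑ ts (λ t → g t y) * ∏ (Vec.map (λ y → ∑ ts (λ t → g t y)) ys) ∎

-- Linear algebra over a finite field by elimination

module LinearAlgebra (𝔽 : FiniteField) where
  open FiniteField 𝔽
  open IsCommutativeRing isCommutativeRing
    using (+-identityʳ; *-assoc; *-comm; *-identityˡ; *-identityʳ; zeroˡ; zeroʳ; -‿inverseˡ; -‿inverseʳ; isCommutativeSemiring)
  open ListSum Carrier _+_ _*_ 0# 1# isCommutativeSemiring public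
  open ≡-Reasoning

  commutativeRing : CommutativeRing 0ℓ 0ℓ
  commutativeRing = record { isCommutativeRing = isCommutativeRing }

  open RingProperties (CommutativeRing.ring commutativeRing) public
    using (-‿distribˡ-*; +-cancelˡ)

  module Solver = NaturalCoefficients (CommutativeRing.commutativeSemiring commutativeRing)

  x*y≢0 : ∀ {x y} → x ≢ 0# → y ≢ 0# → x * y ≢ 0#
  x*y≢0 {x} {y} x≢0 y≢0 xy≡0 with inverse x x≢0
  ... | x⁻¹ , xx⁻¹≡1 = y≢0 (begin
    y                ≡⟨ *-identityˡ y ⟨
    1# * y           ≡⟨ cong (_* y) xx⁻¹≡1 ⟨
    (x * x⁻¹) * y    ≡⟨ cong (_* y) (*-comm x x⁻¹) ⟩
    (x⁻¹ * x) * y    ≡⟨ *-assoc x⁻¹ x y ⟩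
    x⁻¹ * (x * y)    ≡⟨ cong (x⁻¹ *_) xy≡0 ⟩
    x⁻¹ * 0#         ≡⟨ zeroʳ x⁻¹ ⟩
    0#               ∎)

  -- A function of finite support is encoded by the list of its points with their weights, so that
  -- the length of the list measures the support when points are distinct and weights non-zero.
  ⟪_,_⟫ : {I : Set} → List (I × Carrier) → (I → Carrier) → Carrier
  ⟪ ws , f ⟫ = ∑ ws (λ (a , c) → c * f a)

  ⟪⟫-∑ : {I T : Set} (ws : List (I × Carrier)) (ts : List T) (k : T → Carrier) (φ : T → I → Carrier) →
         ⟪ ws , (λ a → ∑ ts (λ t → k t * φ t a)) ⟫ ≡ ∑ ts (λ t → k t * ⟪ ws , φ t ⟫)
  ⟪⟫-∑ ws ts k φ = begin
    ∑ ws (λ (a , c) → c * ∑ ts (λ t → k t * φ t a))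
      ≡⟨ ∑-cong ws (λ {(a , c)} _ → trans (*-distribˡ-∑ c ts _) (∑-cong ts λ _ → exchange c _ _)) ⟩
    ∑ ws (λ (a , c) → ∑ ts (λ t → k t * (c * φ t a)))
      ≡⟨ ∑-comm ws ts _ ⟩
    ∑ ts (λ t → ∑ ws (λ (a , c) → k t * (c * φ t a)))
      ≡⟨ ∑-cong ts (λ {t} _ → sym (*-distribˡ-∑ (k t) ws _)) ⟩
    ∑ ts (λ t → k t * ⟪ ws , φ t ⟫) ∎
    where
    exchange : ∀ a b c → a * (b * c) ≡ b * (a * c)
    exchange a b c = trans (sym (*-assoc a b c)) (trans (cong (_* c) (*-comm a b)) (*-assoc b a c))

  -- Gaussian elimination: a functional f with f a₀ ≠ 0 is cleared from the others by subtracting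
  -- multiples of it, and the weight of a₀ is then chosen so as to kill f.
  annihilator : {I : Set} (k : ℕ) (fs : List (I → Carrier)) → length fs ≡ k →
                (xs : List I) → Unique xs →
                ∃ λ (ws : List (I × Carrier)) →
                  Unique (List.map proj₁ ws) × All (λ (a , c) → a ∈ xs × c ≢ 0#) ws ×
                  length xs ≤ k ℕ.+ length ws × All (λ f → ⟪ ws , f ⟫ ≡ 0#) fs
  annihilator zero [] refl xs u =
      List.map (_, 1#) xs
    , subst Unique (sym (trans (sym (List.map-∘ xs)) (List.map-id xs))) u
    , All.map⁺ (All.tabulate λ a∈ → a∈ , 0≢1 ∘ sym)
    , ℕ.≤-reflexive (sym (List.length-map _ xs))
    , []
  annihilator {I} (suc k) (f ∷ fs) eq xs u with any? (λ a → ¬? (f a ≟ 0#)) xs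
  ... | no none = let ws , uw , on , large , zeros = annihilator k fs (ℕ.suc-injective eq) xs u in
      ws , uw , on , ℕ.m≤n⇒m≤1+n large
    , ∑-zero ws (λ {(a , c)} w∈ → trans (cong (c *_) (f≡0 (proj₁ (All.lookup on w∈)))) (zeroʳ c)) ∷ zeros
    where
    f≡0 : ∀ {a} → a ∈ xs → f a ≡ 0#
    f≡0 {a} a∈ = decidable-stable (f a ≟ 0#) λ fa≢0 → none (lose a∈ fa≢0)
  ... | yes some with find some
  ... | a₀ , a₀∈ , fa₀≢0 with ∈-∃++ a₀∈ | inverse (f a₀) fa₀≢0
  ... | ys , zs , refl | fa₀⁻¹ , inv = result
    where
    xs↭ : xs ↭ a₀ ∷ ys ++ zs
    xs↭ = ↭.shift a₀ ys zs
    uxs : Unique (a₀ ∷ ys ++ zs)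
    uxs = ↭ₛ.Unique-resp-↭ (setoid I) (↭⇒↭ₛ xs↭) u
    a₀∉ : ∀ {a} → a ∈ ys ++ zs → a₀ ≢ a
    a₀∉ = All.lookup (AllPairs.head uxs)
    in-xs : ∀ {a} → a ∈ ys ++ zs → a ∈ xs
    in-xs a∈ = ↭.∈-resp-↭ (↭-sym xs↭) (there a∈)

    μ : (I → Carrier) → Carrier
    μ g = - (g a₀ * fa₀⁻¹)
    reduce : (I → Carrier) → I → Carrier
    reduce g a = g a + μ g * f a

    reduce-a₀ : ∀ g → reduce g a₀ ≡ 0#
    reduce-a₀ g = begin
      g a₀ + - (g a₀ * fa₀⁻¹) * f a₀    ≡⟨ cong (g a₀ +_) (-‿distribˡ-* _ _) ⟨
      g a₀ + - (g a₀ * fa₀⁻¹ * f a₀)    ≡⟨ cong (λ s → g a₀ + - s) (*-assoc _ _ _) ⟩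
      g a₀ + - (g a₀ * (fa₀⁻¹ * f a₀))  ≡⟨ cong (λ s → g a₀ + - (g a₀ * s)) (trans (*-comm _ _) inv) ⟩
      g a₀ + - (g a₀ * 1#)              ≡⟨ cong (λ s → g a₀ + - s) (*-identityʳ _) ⟩
      g a₀ + - g a₀                     ≡⟨ -‿inverseʳ _ ⟩
      0#                                ∎

    kills : ∀ ws g → ⟪ ws , f ⟫ ≡ 0# → ⟪ ws , reduce g ⟫ ≡ 0# → ⟪ ws , g ⟫ ≡ 0#
    kills ws g f≡0 r≡0 = begin
      ⟪ ws , g ⟫                                     ≡⟨ +-identityʳ _ ⟨
      ⟪ ws , g ⟫ + 0#                                ≡⟨ cong (⟪ ws , g ⟫ +_) (zeroʳ (μ g)) ⟨
      ⟪ ws , g ⟫ + μ g * 0#                          ≡⟨ cong (λ s → ⟪ ws , g ⟫ + μ g * s) f≡0 ⟨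
      ⟪ ws , g ⟫ + μ g * ⟪ ws , f ⟫                  ≡⟨ cong (⟪ ws , g ⟫ +_) (*-distribˡ-∑ (μ g) ws _) ⟩
      ⟪ ws , g ⟫ + ∑ ws (λ (a , c) → μ g * (c * f a)) ≡⟨ ∑-distrib-+ ws _ _ ⟨
      ∑ ws (λ (a , c) → c * g a + μ g * (c * f a))   ≡⟨ ∑-cong ws (λ {(a , c)} _ → rearrange c (g a) (μ g) (f a)) ⟩
      ⟪ ws , reduce g ⟫                              ≡⟨ r≡0 ⟩
      0#                                             ∎
      where
      rearrange : ∀ c g m f → c * g + m * (c * f) ≡ c * (g + m * f)
      rearrange = solve 4 (λ c g m f → c :* g :+ m :* (c :* f) := c :* (g :+ m :* f)) refl
        where open Solver

    rec = annihilator k (List.map reduce fs) (trans (List.length-map reduce fs) (ℕ.suc-injective eq))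
            (ys ++ zs) (AllPairs.tail uxs)
    ws′    = proj₁ rec
    uw     = proj₁ (proj₂ rec)
    on     = proj₁ (proj₂ (proj₂ rec))
    large  = proj₁ (proj₂ (proj₂ (proj₂ rec)))
    zeros : ∀ {g} → g ∈ fs → ⟪ ws′ , reduce g ⟫ ≡ 0#
    zeros = All.lookup (All.map⁻ (proj₂ (proj₂ (proj₂ (proj₂ rec)))))

    on′ : All (λ (a , c) → a ∈ xs × c ≢ 0#) ws′
    on′ = All.map (λ (a∈ , c≢0) → in-xs a∈ , c≢0) on

    S c₀ : Carrier
    S = ⟪ ws′ , f ⟫
    c₀ = - (S * fa₀⁻¹)

    c₀f≡-S : c₀ * f a₀ ≡ - S
    c₀f≡-S = begin
      - (S * fa₀⁻¹) * f a₀    ≡⟨ -‿distribˡ-* _ _ ⟨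
      - (S * fa₀⁻¹ * f a₀)    ≡⟨ cong -_ (*-assoc _ _ _) ⟩
      - (S * (fa₀⁻¹ * f a₀))  ≡⟨ cong (λ s → - (S * s)) (trans (*-comm _ _) inv) ⟩
      - (S * 1#)              ≡⟨ cong -_ (*-identityʳ S) ⟩
      - S                     ∎

    c₀≢0 : S ≢ 0# → c₀ ≢ 0#
    c₀≢0 S≢0 c₀≡0 = S≢0 (begin
      S              ≡⟨ +-identityʳ S ⟨
      S + 0#         ≡⟨ cong (S +_) (trans (cong (_* f a₀) c₀≡0) (zeroˡ _)) ⟨
      S + c₀ * f a₀  ≡⟨ cong (S +_) c₀f≡-S ⟩
      S + - S        ≡⟨ -‿inverseʳ S ⟩
      0#             ∎)

    result : ∃ λ ws → Unique (List.map proj₁ ws) × All (λ (a , c) → a ∈ xs × c ≢ 0#) ws ×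
                  length xs ≤ suc k ℕ.+ length ws × All (λ f → ⟪ ws , f ⟫ ≡ 0#) (f ∷ fs)
    result with S ≟ 0#
    -- Here `a₀` would receive weight zero and must stay outside the support. One point is lost,
    -- which is exactly what the bound grants for `f`.
    ... | yes S≡0 = ws′ , uw , on′
        , subst (_≤ suc (k ℕ.+ length ws′)) (sym (↭.↭-length xs↭)) (s≤s large)
        , S≡0 ∷ All.tabulate λ {g} g∈ → kills ws′ g S≡0 (zeros g∈)
    ... | no S≢0 = (a₀ , c₀) ∷ ws′
        , All.map⁺ (All.map (λ (a∈ , _) → a₀∉ a∈) on) ∷ uw
        , (a₀∈ , c₀≢0 S≢0) ∷ on′
        , subst₂ _≤_ (sym (↭.↭-length xs↭)) (sym (cong suc (ℕ.+-suc k (length ws′)))) (s≤s (ℕ.m≤n⇒m≤1+n large))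
        , f≡0 ∷ All.tabulate λ {g} g∈ → kills ((a₀ , c₀) ∷ ws′) g f≡0 (begin
            c₀ * reduce g a₀ + ⟪ ws′ , reduce g ⟫  ≡⟨ cong₂ (λ s t → c₀ * s + t) (reduce-a₀ g) (zeros g∈) ⟩
            c₀ * 0# + 0#                           ≡⟨ +-identityʳ _ ⟩
            c₀ * 0#                                ≡⟨ zeroʳ c₀ ⟩
            0#                                     ∎)
      where
      f≡0 : c₀ * f a₀ + S ≡ 0#
      f≡0 = trans (cong (_+ S) c₀f≡-S) (-‿inverseˡ S)

-- Slice rank of a diagonal tensor

module SliceRank (𝔽 : FiniteField) where
  open FiniteField 𝔽
  open IsCommutativeRing isCommutativeRing
    using (+-identityˡ; +-identityʳ; zeroˡ; zeroʳ)
  open LinearAlgebra 𝔽 public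
  open ≡-Reasoning

  ⟪⟫-cong : {I : Set} {f g : I → Carrier} (ws : List (I × Carrier)) →
            (∀ {a} → a ∈ List.map proj₁ ws → f a ≡ g a) → ⟪ ws , f ⟫ ≡ ⟪ ws , g ⟫
  ⟪⟫-cong ws f≡g = ∑-cong ws λ w∈ → cong (_ *_) (f≡g (∈-map⁺ proj₁ w∈))

  ⟪⟫-single : {I : Set} {f : I → Carrier} {ws : List (I × Carrier)} {y : I} {c : Carrier} →
              Unique (List.map proj₁ ws) → (y , c) ∈ ws →
              (∀ {a} → a ∈ List.map proj₁ ws → a ≢ y → f a ≡ 0#) → ⟪ ws , f ⟫ ≡ c * f y
  ⟪⟫-single {f = f} {(_ , c) ∷ ws} (y∉ ∷ u) (here refl) f≡0 = trans
    (cong (c * _ +_) (∑-zero ws λ w∈ → trans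
      (cong (_ *_) (f≡0 (there (∈-map⁺ proj₁ w∈)) λ { refl → All.lookup y∉ (∈-map⁺ proj₁ w∈) refl }))
      (zeroʳ _)))
    (+-identityʳ _)
  ⟪⟫-single {f = f} {(_ , c) ∷ ws} (y∉ ∷ u) (there w∈) f≡0 = trans
    (cong₂ _+_ (trans (cong (c *_) (f≡0 (here refl) λ { refl → All.lookup y∉ (∈-map⁺ proj₁ w∈) refl })) (zeroʳ c))
               (⟪⟫-single u w∈ (f≡0 ∘ there)))
    (+-identityˡ _)

  -- Tao's slice rank bound: pairing with an h orthogonal to the low functions of z leaves a diagonal
  -- matrix of rank at most 2 ∣ low ∣; a further h′, orthogonal to its column space, must vanish.
  module _ {I E T : Set} (_≟ᴱ_ : DecidableEquality E) (D : I → I → I → Carrier)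
           (φ : E → I → Carrier) (terms : List T) (coef : T → Carrier) (α β γ : T → E)
           (low : List E) (low-unique : Unique low) (xs : List I) (xs-unique : Unique xs)
           (off-diagonal : ∀ {x y z} → x ∈ xs → y ∈ xs → z ∈ xs → D x y z ≢ 0# → x ≡ y × z ≡ y)
           (diagonal : ∀ {x} → x ∈ xs → D x x x ≢ 0#)
           (expansion : ∀ x y z → D x y z ≡ ∑ terms (λ τ → coef τ * (φ (α τ) x * (φ (β τ) y * φ (γ τ) z))))
           (has-low : ∀ {τ} → τ ∈ terms → α τ ∈ low ⊎ β τ ∈ low ⊎ γ τ ∈ low) where

    private
      module _ (ws : List (I × Carrier)) where
        -- Pairing z with `ws` turns the tensor into a matrix in x and y. Its terms with `β τ` equal
        -- to `b` add up to `column b x * φ b y`, so for low `b` the functions `column b` span the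
        -- columns not accounted for by the low `φ a`.
        column : E → I → Carrier
        column b x = ∑ terms (λ τ → (𝟙 (β τ ≟ᴱ b) * (coef τ * ⟪ ws , φ (γ τ) ⟫)) * φ (α τ) x)

        rank-bound : (ws′ : List (I × Carrier)) →
                     (∀ {e} → e ∈ low → ⟪ ws , φ e ⟫ ≡ 0#) →
                     (∀ {e} → e ∈ low → ⟪ ws′ , φ e ⟫ ≡ 0#) →
                     (∀ {e} → e ∈ low → ⟪ ws′ , column e ⟫ ≡ 0#) →
                     ∀ y → ⟪ ws′ , (λ x → ⟪ ws , D x y ⟫) ⟫ ≡ 0#
        rank-bound ws′ γ⊥ α⊥ column⊥ y = begin
          ⟪ ws′ , (λ x → ⟪ ws , D x y ⟫) ⟫
            ≡⟨ ⟪⟫-cong ws′ (λ {x} _ → trans (⟪⟫-cong ws λ {z} _ → trans (expansion x y z)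
                 (∑-cong terms λ _ → pull-z (coef _) _ _ _)) (⟪⟫-∑ ws terms _ _)) ⟩
          ⟪ ws′ , (λ x → ∑ terms (λ τ → ((coef τ * φ (α τ) x) * φ (β τ) y) * ⟪ ws , φ (γ τ) ⟫)) ⟫
            ≡⟨ ⟪⟫-cong ws′ (λ {x} _ → ∑-cong terms λ _ → pull-x (coef _) _ _ _) ⟩
          ⟪ ws′ , (λ x → ∑ terms (λ τ → ((coef τ * φ (β τ) y) * ⟪ ws , φ (γ τ) ⟫) * φ (α τ) x)) ⟫
            ≡⟨ ⟪⟫-∑ ws′ terms _ _ ⟩
          ∑ terms (λ τ → ((coef τ * φ (β τ) y) * ⟪ ws , φ (γ τ) ⟫) * ⟪ ws′ , φ (α τ) ⟫)
            ≡⟨ ∑-cong terms (λ _ → pull-y (coef _) _ _ _) ⟩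
          ∑ terms (λ τ → φ (β τ) y * rest τ)
            ≡⟨ ∑-cong terms (λ τ∈ → sym (group τ∈)) ⟩
          ∑ terms (λ τ → ∑ low (λ b → 𝟙 (β τ ≟ᴱ b) * (φ b y * rest τ)))
            ≡⟨ ∑-comm terms low _ ⟩
          ∑ low (λ b → ∑ terms (λ τ → 𝟙 (β τ ≟ᴱ b) * (φ b y * rest τ)))
            ≡⟨ ∑-zero low vanish ⟩
          0# ∎
          where
          rest : T → Carrier
          rest τ = (coef τ * ⟪ ws , φ (γ τ) ⟫) * ⟪ ws′ , φ (α τ) ⟫

          open Solver
          pull-z : ∀ k a b c → k * (a * (b * c)) ≡ ((k * a) * b) * c
          pull-z = solve 4 (λ k a b c → k :* (a :* (b :* c)) := ((k :* a) :* b) :* c) refl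
          pull-x : ∀ k a b c → ((k * a) * b) * c ≡ ((k * b) * c) * a
          pull-x = solve 4 (λ k a b c → ((k :* a) :* b) :* c := ((k :* b) :* c) :* a) refl
          pull-y : ∀ k b c a → ((k * b) * c) * a ≡ b * ((k * c) * a)
          pull-y = solve 4 (λ k b c a → ((k :* b) :* c) :* a := b :* ((k :* c) :* a)) refl
          pull-b : ∀ i f r a → i * (f * (r * a)) ≡ f * ((i * r) * a)
          pull-b = solve 4 (λ i f r a → i :* (f :* (r :* a)) := f :* ((i :* r) :* a)) refl

          0-times : ∀ {a} → a ≡ 0# → ∀ b → a * b ≡ 0#
          0-times refl b = zeroˡ b
          times-0 : ∀ {b} → b ≡ 0# → ∀ a → a * b ≡ 0#
          times-0 refl a = zeroʳ a

          -- `ws` kills the terms with low `γ` and `ws′` those with low `α`. What remains has low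
          -- `β` and is sorted by the value of `β τ`.
          group : ∀ {τ} → τ ∈ terms →
                  ∑ low (λ b → 𝟙 (β τ ≟ᴱ b) * (φ b y * rest τ)) ≡ φ (β τ) y * rest τ
          group {τ} τ∈ with has-low τ∈
          ... | inj₂ (inj₁ β∈) = ∑-indicator _≟ᴱ_ low-unique β∈ (λ b → φ b y * rest τ)
          ... | inj₁ α∈ = trans (∑-zero low λ _ → times-0 (times-0 rest≡0 _) _) (sym (times-0 rest≡0 _))
            where rest≡0 = times-0 (α⊥ α∈) (coef τ * ⟪ ws , φ (γ τ) ⟫)
          ... | inj₂ (inj₂ γ∈) = trans (∑-zero low λ _ → times-0 (times-0 rest≡0 _) _) (sym (times-0 rest≡0 _))
            where rest≡0 = 0-times (times-0 (γ⊥ γ∈) (coef τ)) ⟪ ws′ , φ (α τ) ⟫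

          vanish : ∀ {b} → b ∈ low → ∑ terms (λ τ → 𝟙 (β τ ≟ᴱ b) * (φ b y * rest τ)) ≡ 0#
          vanish {b} b∈ = begin
            ∑ terms (λ τ → 𝟙 (β τ ≟ᴱ b) * (φ b y * rest τ))
              ≡⟨ ∑-cong terms (λ _ → pull-b _ _ _ _) ⟩
            ∑ terms (λ τ → φ b y * ((𝟙 (β τ ≟ᴱ b) * (coef τ * ⟪ ws , φ (γ τ) ⟫)) * ⟪ ws′ , φ (α τ) ⟫))
              ≡⟨ *-distribˡ-∑ (φ b y) terms _ ⟨
            φ b y * ∑ terms (λ τ → (𝟙 (β τ ≟ᴱ b) * (coef τ * ⟪ ws , φ (γ τ) ⟫)) * ⟪ ws′ , φ (α τ) ⟫)
              ≡⟨ times-0 (trans (sym (⟪⟫-∑ ws′ terms _ _)) (column⊥ b∈)) (φ b y) ⟩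
            0# ∎

    slice-rank-bound : length xs ≤ 3 ℕ.* length low
    slice-rank-bound
      with annihilator (length low) (List.map φ low) (List.length-map φ low) xs xs-unique
    ... | ws , uw , on , large , zeros
      with annihilator (length low ℕ.+ length low) (List.map φ low ++ List.map (column ws) low)
             (trans (List.length-++ (List.map φ low)) (cong₂ ℕ._+_ (List.length-map φ low) (List.length-map (column ws) low)))
             (List.map proj₁ ws) uw
    -- The second weights live on the support of the first and annihilate twice `length low`
    -- functionals. If they come out empty, that support has at most `2 * length low` points and the
    -- bound follows; otherwise any point `y` of their support leads to a contradiction.
    ... | [] , _ , _ , large′ , _ = ℕ.≤-trans large (ℕ.≤-trans
            (ℕ.+-monoʳ-≤ (length low) (subst (_≤ _) (List.length-map proj₁ ws) large′))
            (ℕ.≤-reflexive (three (length low))))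
      where
      three : ∀ l → l ℕ.+ (l ℕ.+ l ℕ.+ 0) ≡ 3 ℕ.* l
      three = ℕ.solve-∀
    ... | (y , c′) ∷ ws′ , uw′ , (y∈ , c′≢0) ∷ on′ , _ , zeros′ with ∈-map⁻ proj₁ y∈
    ... | (_ , c) , w∈ , refl = contradiction (trans (sym value) V≡0) nonzero
      where
      W = (y , c′) ∷ ws′
      in-xs : ∀ {a} → a ∈ List.map proj₁ ws → a ∈ xs
      in-xs a∈ with ∈-map⁻ proj₁ a∈
      ... | _ , v∈ , refl = proj₁ (All.lookup on v∈)
      in-xs′ : ∀ {a} → a ∈ List.map proj₁ W → a ∈ xs
      in-xs′ (here refl) = in-xs y∈
      in-xs′ (there a∈) with ∈-map⁻ proj₁ a∈
      ... | _ , v∈ , refl = in-xs (proj₁ (All.lookup on′ v∈))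
      y∈xs = in-xs y∈

      γ⊥ : ∀ {e} → e ∈ low → ⟪ ws , φ e ⟫ ≡ 0#
      γ⊥ e∈ = All.lookup zeros (∈-map⁺ φ e∈)
      α⊥ : ∀ {e} → e ∈ low → ⟪ W , φ e ⟫ ≡ 0#
      α⊥ e∈ = All.lookup zeros′ (∈-++⁺ˡ (∈-map⁺ φ e∈))
      column⊥ : ∀ {e} → e ∈ low → ⟪ W , column ws e ⟫ ≡ 0#
      column⊥ e∈ = All.lookup zeros′ (∈-++⁺ʳ (List.map φ low) (∈-map⁺ (column ws) e∈))

      V≡0 : ⟪ W , (λ x → ⟪ ws , D x y ⟫) ⟫ ≡ 0#
      V≡0 = rank-bound ws W γ⊥ α⊥ column⊥ y

      -- Diagonality leaves only x = y and z = y in the double sum.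
      value : ⟪ W , (λ x → ⟪ ws , D x y ⟫) ⟫ ≡ c′ * (c * D y y y)
      value = trans
        (⟪⟫-single uw′ (here refl) λ {x} x∈ x≢y → ∑-zero ws λ {(z , k)} v∈ →
          trans (cong (k *_) (decidable-stable (D x y z ≟ 0#) λ D≢0 →
            x≢y (proj₁ (off-diagonal (in-xs′ x∈) y∈xs (in-xs (∈-map⁺ proj₁ v∈)) D≢0)))) (zeroʳ k))
        (cong (c′ *_) (⟪⟫-single uw w∈ λ {z} z∈ z≢y →
          decidable-stable (D y y z ≟ 0#) λ D≢0 → z≢y (proj₂ (off-diagonal y∈xs y∈xs (in-xs z∈) D≢0))))

      nonzero : c′ * (c * D y y y) ≢ 0#
      nonzero = x*y≢0 c′≢0 (x*y≢0 (proj₂ (All.lookup on w∈)) (diagonal y∈xs))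

-- The polynomial tensor and sets without progressions

-- m g is the total degree of the tensor below; each of its monomials has a low-degree factor in x, y or z.
lowDegree : ℕ → (m : ℕ) → List (Vec ℕ m)
lowDegree g m = filter (λ e → 3 ℕ.* Vec.sum e ℕ.≤? m ℕ.* g) (tuples (upTo (suc g)) m)

lowDegree-unique : ∀ g m → Unique (lowDegree g m)
lowDegree-unique g m = Unique.filter⁺ _ (tuples-unique m (Unique.upTo⁺ (suc g)))

some-third : ∀ a b c M → a ℕ.+ (b ℕ.+ c) ≤ M → 3 ℕ.* a ≤ M ⊎ 3 ℕ.* b ≤ M ⊎ 3 ℕ.* c ≤ M
some-third a b c M a+b+c≤M with 3 ℕ.* a ℕ.≤? M | 3 ℕ.* b ℕ.≤? M | 3 ℕ.* c ℕ.≤? M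
... | yes p | _     | _     = inj₁ p
... | _     | yes p | _     = inj₂ (inj₁ p)
... | _     | _     | yes p = inj₂ (inj₂ p)
... | no ¬a | no ¬b | no ¬c = contradiction (begin-strict
    3 ℕ.* M                                  ≡⟨ three M ⟩
    M ℕ.+ (M ℕ.+ M)                          <⟨ ℕ.+-mono-< (ℕ.≰⇒> ¬a) (ℕ.+-mono-< (ℕ.≰⇒> ¬b) (ℕ.≰⇒> ¬c)) ⟩
    3 ℕ.* a ℕ.+ (3 ℕ.* b ℕ.+ 3 ℕ.* c)        ≡⟨ factor a b c ⟩
    3 ℕ.* (a ℕ.+ (b ℕ.+ c))                  ≤⟨ ℕ.*-monoʳ-≤ 3 a+b+c≤M ⟩
    3 ℕ.* M                                  ∎) (ℕ.<-irrefl refl)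
  where
  open ℕ.≤-Reasoning
  three : ∀ M → 3 ℕ.* M ≡ M ℕ.+ (M ℕ.+ M)
  three = ℕ.solve-∀
  factor : ∀ a b c → 3 ℕ.* a ℕ.+ (3 ℕ.* b ℕ.+ 3 ℕ.* c) ≡ 3 ℕ.* (a ℕ.+ (b ℕ.+ c))
  factor = ℕ.solve-∀

module CapSet (𝔽 : FiniteField) where
  open FiniteField 𝔽
  open IsCommutativeRing isCommutativeRing
    using (+-assoc; +-identityˡ; +-identityʳ; *-assoc; *-identityˡ; distribʳ; zeroˡ; zeroʳ; -‿inverseˡ; -‿inverseʳ)
  open SliceRank 𝔽 public
  open ≡-Reasoning

  infixl 6 _⊕ᵛ_
  _⊕ᵛ_ : ∀ {m} → Space 𝔽 m → Space 𝔽 m → Space 𝔽 m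
  _⊕ᵛ_ = _⊕_ 𝔽

  ∈-elements : ∀ x → x ∈ elements
  ∈-elements x = subst (_∈ elements) (Inverse.strictlyInverseʳ enumeration x)
    (∈-map⁺ (Inverse.from enumeration) (∈-allFin _))

  length-elements : length elements ≡ order
  length-elements = trans (List.length-map _ (allFin order)) (List.length-tabulate {n = order} id)

  nonzeros : List Carrier
  nonzeros = filter (λ c → ¬? (c ≟ 0#)) elements

  length-nonzeros : length nonzeros ≤ order ∸ 1
  length-nonzeros = ℕ.<⇒≤pred (subst (length nonzeros <_) length-elements
    (List.filter-notAll _ elements (lose (∈-elements 0#) λ 0≢0 → 0≢0 refl)))

  infixr 8 _↑_
  _↑_ : Carrier → ℕ → Carrier
  x ↑ zero  = 1#
  x ↑ suc k = x * x ↑ k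

  record Term : Set where
    constructor term
    field
      coef    : Carrier
      a b c   : ℕ
  open Term

  Triple : Set
  Triple = Carrier × Carrier × Carrier

  eval : Term → Triple → Carrier
  eval (term k a b c) (u , v , w) = k * (u ↑ a * (v ↑ b * w ↑ c))

  κ : Carrier
  κ = - (1# + 1#)

  form : Triple → Carrier
  form (u , v , w) = u + (v + κ * w)

  -- Over all c ≠ 0, this product has degree q − 1 and vanishes exactly when form p ≠ 0.
  product : List Carrier → Triple → Carrier
  product []       p = 1#
  product (c ∷ cs) p = (c + form p) * product cs p

  -- Each factor contributes one of its four summands. Like terms are left uncollected: the slice
  -- rank bound counts the low exponents and not the terms.
  expand : List Carrier → List Term
  expand []       = term 1# 0 0 0 ∷ []
  expand (d ∷ cs) =
       List.map (λ (term k a b c) → term (d * k) a b c) (expand cs)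
    ++ List.map (λ (term k a b c) → term k (suc a) b c) (expand cs)
    ++ List.map (λ (term k a b c) → term k a (suc b) c) (expand cs)
    ++ List.map (λ (term k a b c) → term (κ * k) a b (suc c)) (expand cs)

  ∑-expand : ∀ cs p → ∑ (expand cs) (λ t → eval t p) ≡ product cs p
  ∑-expand []       p = trans (+-identityʳ _) (trans (*-identityˡ _) (trans (*-identityˡ _) (*-identityˡ _)))
  ∑-expand (d ∷ cs) p@(u , v , w) = begin
    ∑ (expand (d ∷ cs)) (λ t → eval t p)
      ≡⟨ trans (∑-++ (List.map _ ts) _ _) (cong₂ _+_ (∑-map _ ts _)
        (trans (∑-++ (List.map _ ts) _ _) (cong₂ _+_ (∑-map _ ts _)
          (trans (∑-++ (List.map _ ts) _ _) (cong₂ _+_ (∑-map _ ts _) (∑-map _ ts _)))))) ⟩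
    ∑ ts (λ t → (d * coef t) * (u ↑ a t * (v ↑ b t * w ↑ c t)))
      + (∑ ts (λ t → coef t * (u * u ↑ a t * (v ↑ b t * w ↑ c t)))
      + (∑ ts (λ t → coef t * (u ↑ a t * (v * v ↑ b t * w ↑ c t)))
      + ∑ ts (λ t → (κ * coef t) * (u ↑ a t * (v ↑ b t * (w * w ↑ c t))))))
      ≡⟨ cong₂ _+_ (scale d λ t → *-assoc _ _ _)
        (cong₂ _+_ (scale u λ t → pull-u (coef t) u _ _ _)
          (cong₂ _+_ (scale v λ t → pull-v (coef t) _ v _ _) (scale (κ * w) λ t → pull-w κ (coef t) _ _ w _))) ⟩
    d * Σts + (u * Σts + (v * Σts + (κ * w) * Σts))
      ≡⟨ collect d u v (κ * w) Σts ⟩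
    (d + form p) * Σts
      ≡⟨ cong ((d + form p) *_) (∑-expand cs p) ⟩
    (d + form p) * product cs p ∎
    where
    ts  = expand cs
    Σts = ∑ ts (λ t → eval t p)

    scale : {f : Term → Carrier} (s : Carrier) → (∀ t → f t ≡ s * eval t p) → ∑ ts f ≡ s * Σts
    scale s f≡ = trans (∑-cong ts λ {t} _ → f≡ t) (sym (*-distribˡ-∑ s ts _))

    open Solver
    pull-u : ∀ k u a b c → k * (u * a * (b * c)) ≡ u * (k * (a * (b * c)))
    pull-u = solve 5 (λ k u a b c → k :* (u :* a :* (b :* c)) := u :* (k :* (a :* (b :* c)))) refl
    pull-v : ∀ k a v b c → k * (a * (v * b * c)) ≡ v * (k * (a * (b * c)))
    pull-v = solve 5 (λ k a v b c → k :* (a :* (v :* b :* c)) := v :* (k :* (a :* (b :* c)))) refl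
    pull-w : ∀ l k a b w c → (l * k) * (a * (b * (w * c))) ≡ (l * w) * (k * (a * (b * c)))
    pull-w = solve 6 (λ l k a b w c → (l :* k) :* (a :* (b :* (w :* c))) := (l :* w) :* (k :* (a :* (b :* c)))) refl
    collect : ∀ d u v w s → d * s + (u * s + (v * s + w * s)) ≡ (d + (u + (v + w))) * s
    collect = solve 5 (λ d u v w s → d :* s :+ (u :* s :+ (v :* s :+ w :* s)) := (d :+ (u :+ (v :+ w))) :* s) refl

  degree : Term → ℕ
  degree t = a t ℕ.+ (b t ℕ.+ c t)

  expand-degree : ∀ cs → All (λ t → degree t ≤ length cs) (expand cs)
  expand-degree []       = z≤n ∷ []
  expand-degree (d ∷ cs) =
    All.++⁺ (All.map⁺ (All.map ℕ.m≤n⇒m≤1+n ih))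
    (All.++⁺ (All.map⁺ (All.map s≤s ih))
    (All.++⁺ (All.map⁺ (All.map (λ {t} le → ℕ.≤-trans (ℕ.≤-reflexive (ℕ.+-suc (a t) _)) (s≤s le)) ih))
    (All.map⁺ (All.map (λ {t} le → ℕ.≤-trans
      (ℕ.≤-reflexive (trans (cong (a t ℕ.+_) (ℕ.+-suc (b t) (c t))) (ℕ.+-suc (a t) _))) (s≤s le)) ih))))
    where ih = expand-degree cs

  triples : ∀ {m} → Space 𝔽 m → Space 𝔽 m → Space 𝔽 m → Vec Triple m
  triples []       []       []       = []
  triples (x ∷ xs) (y ∷ ys) (z ∷ zs) = (x , y , z) ∷ triples xs ys zs

  tensor : ∀ {m} → Space 𝔽 m → Space 𝔽 m → Space 𝔽 m → Carrier
  tensor x y z = ∏ (Vec.map (product nonzeros) (triples x y z))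

  monomial : ∀ {m} → Vec ℕ m → Space 𝔽 m → Carrier
  monomial []       []       = 1#
  monomial (k ∷ ks) (x ∷ xs) = x ↑ k * monomial ks xs

  tensor-expansion : ∀ {m} (x y z : Space 𝔽 m) → tensor x y z ≡
    ∑ (tuples (expand nonzeros) m) (λ τ → ∏ (Vec.map coef τ) *
      (monomial (Vec.map a τ) x * (monomial (Vec.map b τ) y * monomial (Vec.map c τ) z)))
  tensor-expansion {m} x y z = begin
    tensor x y z
      ≡⟨ cong ∏ (Vec.map-cong (λ p → sym (∑-expand nonzeros p)) (triples x y z)) ⟩
    ∏ (Vec.map (λ p → ∑ (expand nonzeros) (λ t → eval t p)) (triples x y z))
      ≡⟨ ∑-∏ (expand nonzeros) eval (triples x y z) ⟨
    ∑ (tuples (expand nonzeros) m) (λ τ → ∏ (zipWith eval τ (triples x y z)))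
      ≡⟨ ∑-cong (tuples (expand nonzeros) m) (λ {τ} _ → separate τ x y z) ⟩
    ∑ (tuples (expand nonzeros) m) (λ τ → ∏ (Vec.map coef τ) *
      (monomial (Vec.map a τ) x * (monomial (Vec.map b τ) y * monomial (Vec.map c τ) z))) ∎
    where
    open Solver
    regroup : ∀ k u v w k′ u′ v′ w′ → (k * (u * (v * w))) * (k′ * (u′ * (v′ * w′))) ≡
              (k * k′) * ((u * u′) * ((v * v′) * (w * w′)))
    regroup = solve 8 (λ k u v w k′ u′ v′ w′ → (k :* (u :* (v :* w))) :* (k′ :* (u′ :* (v′ :* w′))) :=
              (k :* k′) :* ((u :* u′) :* ((v :* v′) :* (w :* w′)))) refl
    separate : ∀ {m} (τ : Vec Term m) (x y z : Space 𝔽 m) → ∏ (zipWith eval τ (triples x y z)) ≡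
      ∏ (Vec.map coef τ) * (monomial (Vec.map a τ) x * (monomial (Vec.map b τ) y * monomial (Vec.map c τ) z))
    separate []      []       []       []       =
      sym (trans (*-identityˡ _) (trans (*-identityˡ _) (*-identityˡ _)))
    separate (t ∷ τ) (x ∷ xs) (y ∷ ys) (z ∷ zs) =
      trans (cong (eval t (x , y , z) *_) (separate τ xs ys zs))
            (regroup (coef t) (x ↑ a t) (y ↑ b t) (z ↑ c t) _ _ _ _)

  has-low-degree : ∀ {m τ} → τ ∈ tuples (expand nonzeros) m →
    let low = lowDegree (order ∸ 1) m in
    Vec.map a τ ∈ low ⊎ Vec.map b τ ∈ low ⊎ Vec.map c τ ∈ low
  has-low-degree {m} {τ} τ∈ =
    low (some-third (Vec.sum (Vec.map a τ)) (Vec.sum (Vec.map b τ)) (Vec.sum (Vec.map c τ)) (m ℕ.* g) (total degrees))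
    where
    g = order ∸ 1
    degrees : VAll (λ t → degree t ≤ g) τ
    degrees = VAll.map (λ t∈ → ℕ.≤-trans (All.lookup (expand-degree nonzeros) t∈) length-nonzeros)
      (∈-tuples⁻ (expand nonzeros) m τ∈)

    total : ∀ {m} {τ : Vec Term m} → VAll (λ t → degree t ≤ g) τ →
      Vec.sum (Vec.map a τ) ℕ.+ (Vec.sum (Vec.map b τ) ℕ.+ Vec.sum (Vec.map c τ)) ≤ m ℕ.* g
    total []                       = z≤n
    total {τ = t ∷ τ} (le ∷ les) = ℕ.≤-trans
      (ℕ.≤-reflexive (sym (regroup (a t) (b t) (c t) _ _ _))) (ℕ.+-mono-≤ le (total les))
      where
      regroup : ∀ a b c x y z → (a ℕ.+ (b ℕ.+ c)) ℕ.+ (x ℕ.+ (y ℕ.+ z)) ≡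
                (a ℕ.+ x) ℕ.+ ((b ℕ.+ y) ℕ.+ (c ℕ.+ z))
      regroup = ℕ.solve-∀

    in-box : (f : Term → ℕ) → (∀ t → f t ≤ degree t) → ∀ {m} {τ : Vec Term m} →
             VAll (λ t → degree t ≤ g) τ → Vec.map f τ ∈ tuples (upTo (suc g)) m
    in-box f f≤ les = ∈-tuples⁺ (bounded les)
      where
      bounded : ∀ {m} {τ : Vec Term m} → VAll (λ t → degree t ≤ g) τ → VAll (_∈ upTo (suc g)) (Vec.map f τ)
      bounded []         = []
      bounded (le ∷ les) = ∈-upTo⁺ (s≤s (ℕ.≤-trans (f≤ _) le)) ∷ bounded les

    a≤ : ∀ t → a t ≤ degree t
    a≤ t = ℕ.m≤m+n (a t) _
    b≤ : ∀ t → b t ≤ degree t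
    b≤ t = ℕ.≤-trans (ℕ.m≤m+n (b t) (c t)) (ℕ.m≤n+m _ (a t))
    c≤ : ∀ t → c t ≤ degree t
    c≤ t = ℕ.≤-trans (ℕ.m≤n+m (c t) (b t)) (ℕ.m≤n+m _ (a t))

    low : 3 ℕ.* Vec.sum (Vec.map a τ) ≤ m ℕ.* g ⊎ 3 ℕ.* Vec.sum (Vec.map b τ) ≤ m ℕ.* g ⊎
          3 ℕ.* Vec.sum (Vec.map c τ) ≤ m ℕ.* g →
          Vec.map a τ ∈ lowDegree g m ⊎ Vec.map b τ ∈ lowDegree g m ⊎ Vec.map c τ ∈ lowDegree g m
    low (inj₁ p)        = inj₁ (∈-filter⁺ _ (in-box a a≤ degrees) p)
    low (inj₂ (inj₁ p)) = inj₂ (inj₁ (∈-filter⁺ _ (in-box b b≤ degrees) p))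
    low (inj₂ (inj₂ p)) = inj₂ (inj₂ (∈-filter⁺ _ (in-box c c≤ degrees) p))

  κ*w : ∀ w → κ * w ≡ - (w + w)
  κ*w w = trans (sym (-‿distribˡ-* (1# + 1#) w))
    (cong -_ (trans (distribʳ w 1# 1#) (cong₂ _+_ (*-identityˡ w) (*-identityˡ w))))

  form-0 : ∀ u v w → form (u , v , w) ≡ 0# → u + v ≡ w + w
  form-0 u v w eq = begin
    u + v                            ≡⟨ +-identityʳ _ ⟨
    (u + v) + 0#                     ≡⟨ cong ((u + v) +_) (-‿inverseˡ (w + w)) ⟨
    (u + v) + (- (w + w) + (w + w))  ≡⟨ +-assoc _ _ _ ⟨
    ((u + v) + - (w + w)) + (w + w)  ≡⟨ cong (_+ (w + w)) (trans (+-assoc _ _ _) (cong (λ s → u + (v + s)) (sym (κ*w w)))) ⟩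
    form (u , v , w) + (w + w)       ≡⟨ cong (_+ (w + w)) eq ⟩
    0# + (w + w)                     ≡⟨ +-identityˡ _ ⟩
    w + w                            ∎

  form-diagonal : ∀ u → form (u , u , u) ≡ 0#
  form-diagonal u = trans (cong (λ s → u + (u + s)) (κ*w u)) (trans (sym (+-assoc _ _ _)) (-‿inverseʳ (u + u)))

  product-0 : ∀ {p} cs → - form p ∈ cs → product cs p ≡ 0#
  product-0 {p} (c ∷ cs) (here eq)  = trans (cong (λ d → (d + form p) * product cs p) (sym eq))
    (trans (cong (_* product cs p) (-‿inverseˡ _)) (zeroˡ _))
  product-0 {p} (c ∷ cs) (there c∈) = trans (cong (_ *_) (product-0 cs c∈)) (zeroʳ _)

  product≢0⇒form≡0 : ∀ {p} → product nonzeros p ≢ 0# → form p ≡ 0#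
  product≢0⇒form≡0 {p} P≢0 = decidable-stable (form p ≟ 0#) λ f≢0 →
    P≢0 (product-0 nonzeros (∈-filter⁺ _ (∈-elements _) λ -f≡0 → f≢0 (begin
      form p            ≡⟨ +-identityʳ _ ⟨
      form p + 0#       ≡⟨ cong (form p +_) -f≡0 ⟨
      form p + - form p ≡⟨ -‿inverseʳ _ ⟩
      0#                ∎)))

  tensor-support : ∀ {m} (x y z : Space 𝔽 m) → tensor x y z ≢ 0# → x ⊕ᵛ y ≡ z ⊕ᵛ z
  tensor-support []       []       []       _   = refl
  tensor-support (x ∷ xs) (y ∷ ys) (z ∷ zs) T≢0 = cong₂ _∷_
    (form-0 x y z (product≢0⇒form≡0 λ P≡0 → T≢0 (trans (cong (_* _) P≡0) (zeroˡ _))))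
    (tensor-support xs ys zs λ T≡0 → T≢0 (trans (cong (_ *_) T≡0) (zeroʳ _)))

  -- On the diagonal `form` vanishes, so each coordinate contributes the product of all non-zero
  -- field elements.
  tensor-diagonal : ∀ {m} (x : Space 𝔽 m) → tensor x x x ≢ 0#
  tensor-diagonal []       = 0≢1 ∘ sym
  tensor-diagonal (x ∷ xs) = x*y≢0 (product≢0 nonzeros (λ c∈ → proj₂ (∈-filter⁻ _ {xs = elements} c∈))) (tensor-diagonal xs)
    where
    product≢0 : ∀ cs → (∀ {c} → c ∈ cs → c ≢ 0#) → product cs (x , x , x) ≢ 0#
    product≢0 []       _   = 0≢1 ∘ sym
    product≢0 (c ∷ cs) c≢0 = x*y≢0
      (λ eq → c≢0 (here refl) (trans (sym (trans (cong (c +_) (form-diagonal x)) (+-identityʳ c))) eq))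
      (product≢0 cs (c≢0 ∘ there))

  ⊕-cancelˡ : ∀ {m} (x : Space 𝔽 m) {y z} → x ⊕ᵛ y ≡ x ⊕ᵛ z → y ≡ z
  ⊕-cancelˡ []       {[]}     {[]}     _  = refl
  ⊕-cancelˡ (x ∷ xs) {y ∷ ys} {z ∷ zs} eq =
    cong₂ _∷_ (+-cancelˡ x y z (Vec.∷-injectiveˡ eq)) (⊕-cancelˡ xs (Vec.∷-injectiveʳ eq))

  cap-set-bound : ∀ {m} (xs : List (Space 𝔽 m)) → Unique xs →
    (∀ {x y z} → x ∈ xs → y ∈ xs → z ∈ xs → x ⊕ᵛ y ≡ z ⊕ᵛ z → x ≡ z) →
    length xs ≤ 3 ℕ.* length (lowDegree (order ∸ 1) m)
  cap-set-bound {m} xs u trivial = slice-rank-bound (Vec.≡-dec ℕ._≟_) tensor monomial (tuples (expand nonzeros) m)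
    (λ τ → ∏ (Vec.map coef τ)) (Vec.map a) (Vec.map b) (Vec.map c) _ (lowDegree-unique (order ∸ 1) m) xs u
    off-diagonal (λ {x} _ → tensor-diagonal x) tensor-expansion has-low-degree
    where
    off-diagonal : ∀ {x y z} → x ∈ xs → y ∈ xs → z ∈ xs → tensor x y z ≢ 0# → x ≡ y × z ≡ y
    off-diagonal {x} {y} {z} x∈ y∈ z∈ T≢0 with trivial x∈ y∈ z∈ (tensor-support x y z T≢0)
    -- Once x = z, the equation reads x + y = x + x, and cancellation gives y = x in every
    -- characteristic.
    ... | refl = sym y≡x , sym y≡x
      where y≡x = ⊕-cancelˡ x (tensor-support x y x T≢0)

-- Counting monomials of low degree

module ℕ∑ = ListSum ℕ ℕ._+_ ℕ._*_ 0 1 ℕ.+-*-isCommutativeSemiring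

module Counting where
  open import Data.Nat.Base using (_+_; _*_)
  open ℕ∑
  open ℕ.≤-Reasoning

  ∑-mono-≤ : {I : Set} {f g : I → ℕ} (xs : List I) → (∀ {x} → x ∈ xs → f x ≤ g x) → ∑ xs f ≤ ∑ xs g
  ∑-mono-≤ []       f≤g = z≤n
  ∑-mono-≤ (x ∷ xs) f≤g = ℕ.+-mono-≤ (f≤g (here refl)) (∑-mono-≤ xs (f≤g ∘ there))

  ∑-const : {I : Set} (xs : List I) (c : ℕ) → ∑ xs (λ _ → c) ≡ length xs * c
  ∑-const []       c = refl
  ∑-const (x ∷ xs) c = cong (c +_) (∑-const xs c)

  length-filter-≡ : {I : Set} {P : Pred I 0ℓ} (P? : Decidable P) (xs : List I) →
                    length (filter P? xs) ≡ ∑ xs (λ x → 𝟙 (P? x))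
  length-filter-≡ P? []       = refl
  length-filter-≡ P? (x ∷ xs) with P? x
  ... | yes _ = cong suc (length-filter-≡ P? xs)
  ... | no _  = length-filter-≡ P? xs

  -- Markov's inequality.
  length-filter-* : {I : Set} {P : Pred I 0ℓ} (P? : Decidable P) (xs : List I) {f : I → ℕ} {c : ℕ} →
                    (∀ {x} → x ∈ xs → P x → c ≤ f x) → length (filter P? xs) * c ≤ ∑ xs f
  length-filter-* P? []       c≤f = z≤n
  length-filter-* P? (x ∷ xs) c≤f with P? x
  ... | yes px = ℕ.+-mono-≤ (c≤f (here refl) px) (length-filter-* P? xs (c≤f ∘ there))
  ... | no _   = ℕ.≤-trans (length-filter-* P? xs (c≤f ∘ there)) (ℕ.m≤n+m _ _)

  ∑-tuples : {I : Set} (xs : List I) (w : I → ℕ) (m : ℕ) →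
             ∑ (tuples xs m) (λ v → ∏ (Vec.map w v)) ≡ ∑ xs w ^ m
  ∑-tuples xs w zero    = refl
  ∑-tuples xs w (suc m) = trans (∑-cartesianProductWith _∷_ xs (tuples xs m) _)
    (trans (∑-*-∑ xs (tuples xs m) w _) (cong (∑ xs w *_) (∑-tuples xs w m)))

  ^-distribʳ-* : ∀ n a b → (a * b) ^ n ≡ a ^ n * b ^ n
  ^-distribʳ-* zero    a b = refl
  ^-distribʳ-* (suc n) a b = trans (cong (a * b *_) (^-distribʳ-* n a b)) (*-interchange a b (a ^ n) (b ^ n))

  -- Bernoulli's inequality (1 - 1/N)^k ≥ 1 - k/N for N = p + 1, with denominators cleared and the
  -- subtraction moved across.
  bernoulli : ∀ p k → suc p * suc p ^ k ≤ suc p * p ^ k + k * suc p ^ k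
  bernoulli p zero    = ℕ.m≤m+n _ 0
  bernoulli p (suc k) = begin
    suc p * (suc p * Z)                         ≤⟨ ℕ.*-monoʳ-≤ (suc p) (bernoulli p k) ⟩
    suc p * (suc p * X + k * Z)                 ≡⟨ expand p X Z k ⟩
    suc p * (p * X) + suc p * X + k * (suc p * Z) ≤⟨ ℕ.+-monoˡ-≤ _ (ℕ.+-monoʳ-≤ (suc p * (p * X)) (ℕ.*-monoʳ-≤ (suc p) (ℕ.^-monoˡ-≤ k (ℕ.n≤1+n p)))) ⟩
    suc p * (p * X) + suc p * Z + k * (suc p * Z) ≡⟨ ℕ.+-assoc (suc p * (p * X)) _ _ ⟩
    suc p * (p * X) + suc k * (suc p * Z)       ∎
    where
    X = p ^ k
    Z = suc p ^ k
    expand : ∀ p X Z k → suc p * (suc p * X + k * Z) ≡ suc p * (p * X) + suc p * X + k * (suc p * Z)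
    expand = ℕ.solve-∀

  -- From (1 - 1/N)(1 + 1/N) ≤ 1 and (1 + 1/N)^k ≥ 1 + k/N one gets (1 - 1/N)^k ≤ 1/(1 + k/N), where
  -- N = p + 1. With 1/(1 + u) ≤ 1 - u + u² this yields `power-upper`.
  bernoulli⁻¹ : ∀ p k → p ^ k * (suc p + k) ≤ suc p * suc p ^ k
  bernoulli⁻¹ p zero    = ℕ.≤-reflexive (base p)
    where
    base : ∀ p → 1 * (suc p + 0) ≡ suc p * 1
    base = ℕ.solve-∀
  bernoulli⁻¹ p (suc k) = begin
    p * p ^ k * (suc p + suc k)                        ≤⟨ ℕ.m≤m+n _ _ ⟩
    p * p ^ k * (suc p + suc k) + p ^ k * (1 + k)      ≡⟨ expand p (p ^ k) k ⟩
    suc p * (p ^ k * (suc p + k))                      ≤⟨ ℕ.*-monoʳ-≤ (suc p) (bernoulli⁻¹ p k) ⟩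
    suc p * (suc p * suc p ^ k)                        ∎
    where
    expand : ∀ p X k → p * X * (suc p + suc k) + X * (1 + k) ≡ suc p * (X * (suc p + k))
    expand = ℕ.solve-∀

  -- (1 − 1/N)^k ≤ 1 − k/N + (k/N)² with N = p + 1, cleared of denominators and of subtractions.
  power-upper : ∀ p k → let N = suc p in
                p ^ k * (N * N) + k * N * N ^ k ≤ N ^ k * (N * N + k * k)
  power-upper p k = ℕ.*-cancelʳ-≤ _ _ (N + k) (begin
    (X * (N * N) + k * N * Z) * (N + k)                ≡⟨ expandˡ X N k Z ⟩
    X * (N + k) * (N * N) + k * N * Z * (N + k)        ≤⟨ ℕ.+-monoˡ-≤ _ (ℕ.*-monoˡ-≤ (N * N) (bernoulli⁻¹ p k)) ⟩
    N * Z * (N * N) + k * N * Z * (N + k)              ≤⟨ ℕ.m≤m+n _ (Z * (k * (k * k))) ⟩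
    N * Z * (N * N) + k * N * Z * (N + k) + Z * (k * (k * k)) ≡⟨ expandʳ N k Z ⟩
    Z * (N * N + k * k) * (N + k)                      ∎)
    where
    N = suc p
    X = p ^ k
    Z = N ^ k
    expandˡ : ∀ X N k Z → (X * (N * N) + k * N * Z) * (N + k) ≡ X * (N + k) * (N * N) + k * N * Z * (N + k)
    expandˡ = ℕ.solve-∀
    expandʳ : ∀ N k Z → N * Z * (N * N) + k * N * Z * (N + k) + Z * (k * (k * k)) ≡ Z * (N * N + k * k) * (N + k)
    expandʳ = ℕ.solve-∀

  ∑-upTo : ∀ n → 2 * ∑ (upTo (suc n)) id ≡ n * suc n
  ∑-upTo n = go n
    where
    snoc : ∀ n (f : ℕ → ℕ) → ∑ (List.applyUpTo f (suc n)) id ≡ ∑ (List.applyUpTo f n) id + f n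
    snoc zero    f = ℕ.+-identityʳ (f 0)
    snoc (suc n) f = trans (cong (f 0 +_) (snoc n (f ∘ suc))) (sym (ℕ.+-assoc (f 0) _ _))
    go : ∀ n → 2 * ∑ (upTo (suc n)) id ≡ n * suc n
    go zero    = refl
    go (suc n) = trans (cong (2 *_) (snoc (suc n) id)) (trans (ℕ.*-distribˡ-+ 2 (∑ (upTo (suc n)) id) (suc n))
      (trans (cong (_+ 2 * suc n) (go n)) (arith n)))
      where
      arith : ∀ n → n * suc n + 2 * suc n ≡ suc n * suc (suc n)
      arith = ℕ.solve-∀

  -- Chernoff's method with the weights t^(3a), t = 1 − 1/N and N = 36 g, scaled to integers.
  module Chernoff (g p : ℕ) .{{_ : NonZero g}} (N≡36g : suc p ≡ 36 * g) where
    -- `Z` is the weight of exponent 0. `W` is what the weight would be at the threshold exponent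
    -- g/3, namely N^(3g) t^g.
    N Z W S : ℕ
    N = suc p
    Z = N ^ (3 * g)
    W = p ^ g * N ^ (2 * g)

    weight : ℕ → ℕ
    weight a = p ^ (3 * a) * N ^ (3 * (g ∸ a))

    S = ∑ (upTo (suc g)) weight

    weight-bound : ∀ {a} → a ≤ g → weight a * (N * N) + 3 * N * Z * a ≤ Z * (N * N + 9 * (g * g))
    weight-bound {a} a≤g = begin
      p ^ k * R * (N * N) + 3 * N * Z * a               ≡⟨ cong (λ z → p ^ k * R * (N * N) + 3 * N * z * a) Z≡ ⟩
      p ^ k * R * (N * N) + 3 * N * (N ^ k * R) * a     ≡⟨ expand (p ^ k) R N (N ^ k) a ⟩
      (p ^ k * (N * N) + k * N * N ^ k) * R             ≤⟨ ℕ.*-monoˡ-≤ R (power-upper p k) ⟩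
      N ^ k * (N * N + k * k) * R                       ≡⟨ regroup (N ^ k) (N * N) a R ⟩
      N ^ k * R * (N * N + 9 * (a * a))                 ≡⟨ cong (_* (N * N + 9 * (a * a))) Z≡ ⟨
      Z * (N * N + 9 * (a * a))                         ≤⟨ ℕ.*-monoʳ-≤ Z (ℕ.+-monoʳ-≤ (N * N) (ℕ.*-monoʳ-≤ 9 (ℕ.*-mono-≤ a≤g a≤g))) ⟩
      Z * (N * N + 9 * (g * g))                         ∎
      where
      k = 3 * a
      R = N ^ (3 * (g ∸ a))
      Z≡ : Z ≡ N ^ k * R
      Z≡ = trans (cong (N ^_) (trans (cong (3 *_) (sym (ℕ.m+[n∸m]≡n a≤g))) (ℕ.*-distribˡ-+ 3 a (g ∸ a))))
        (ℕ.^-distribˡ-+-* N k (3 * (g ∸ a)))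
      expand : ∀ X R N Y a → X * R * (N * N) + 3 * N * (Y * R) * a ≡ (X * (N * N) + 3 * a * N * Y) * R
      expand = ℕ.solve-∀
      regroup : ∀ Y M a R → Y * (M + 3 * a * (3 * a)) * R ≡ Y * R * (M + 9 * (a * a))
      regroup = ℕ.solve-∀

    S-bound₁ : 2 * (S * (N * N)) + 3 * N * Z * (g * suc g) ≤ 2 * (suc g * (Z * (N * N + 9 * (g * g))))
    S-bound₁ = begin
      2 * (S * (N * N)) + 3 * N * Z * (g * suc g)       ≡⟨ cong (λ s → 2 * (S * (N * N)) + 3 * N * Z * s) (∑-upTo g) ⟨
      2 * (S * (N * N)) + 3 * N * Z * (2 * ∑ as id)     ≡⟨ factor (S * (N * N)) (3 * N * Z) (∑ as id) ⟩
      2 * (S * (N * N) + 3 * N * Z * ∑ as id)           ≡⟨ cong (2 *_) (cong₂ _+_ (*-distribʳ-∑ (N * N) as weight) (*-distribˡ-∑ (3 * N * Z) as id)) ⟩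
      2 * (∑ as (λ a → weight a * (N * N)) + ∑ as (λ a → 3 * N * Z * a)) ≡⟨ cong (2 *_) (∑-distrib-+ as (λ a → weight a * (N * N)) (λ a → 3 * N * Z * a)) ⟨
      2 * ∑ as (λ a → weight a * (N * N) + 3 * N * Z * a) ≤⟨ ℕ.*-monoʳ-≤ 2 (∑-mono-≤ as λ a∈ → weight-bound (s≤s⁻¹ (∈-upTo⁻ a∈))) ⟩
      2 * ∑ as (λ _ → Z * (N * N + 9 * (g * g)))        ≡⟨ cong (2 *_) (∑-const as (Z * (N * N + 9 * (g * g)))) ⟩
      2 * (length as * (Z * (N * N + 9 * (g * g))))     ≡⟨ cong (λ l → 2 * (l * (Z * (N * N + 9 * (g * g))))) (List.length-upTo (suc g)) ⟩
      2 * (suc g * (Z * (N * N + 9 * (g * g))))         ∎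
      where
      as = upTo (suc g)
      factor : ∀ x c s → 2 * x + c * (2 * s) ≡ 2 * (x + c * s)
      factor = ℕ.solve-∀

    -- With N = 36 g, the mean exponent g/2 gains (3/2) g/N = 108/2592, while the quadratic error,
    -- bounded by its value at a = g, costs 9 g²/N² = 18/2592.
    S-bound₂ : 2592 * S ≤ 2502 * (suc g * Z)
    S-bound₂ = ℕ.+-cancelʳ-≤ (108 * (suc g * Z)) _ _ (ℕ.*-cancelˡ-≤ (g * g) {{ℕ.m*n≢0 g g}} (begin
      g * g * (2592 * S + 108 * (suc g * Z))            ≡⟨ expandˡ g S Z ⟩
      2 * (S * (36 * g * (36 * g))) + 3 * (36 * g) * Z * (g * suc g)
        ≡⟨ cong (λ n → 2 * (S * (n * n)) + 3 * n * Z * (g * suc g)) N≡36g ⟨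
      2 * (S * (N * N)) + 3 * N * Z * (g * suc g)       ≤⟨ S-bound₁ ⟩
      2 * (suc g * (Z * (N * N + 9 * (g * g))))         ≡⟨ cong (λ n → 2 * (suc g * (Z * (n * n + 9 * (g * g))))) N≡36g ⟩
      2 * (suc g * (Z * (36 * g * (36 * g) + 9 * (g * g)))) ≡⟨ expandʳ g Z ⟩
      g * g * (2502 * (suc g * Z) + 108 * (suc g * Z))  ∎))
      where
      expandˡ : ∀ g S Z → g * g * (2592 * S + 108 * (suc g * Z)) ≡ 2 * (S * (36 * g * (36 * g))) + 3 * (36 * g) * Z * (g * suc g)
      expandˡ = ℕ.solve-∀
      expandʳ : ∀ g Z → 2 * (suc g * (Z * (36 * g * (36 * g) + 9 * (g * g)))) ≡ g * g * (2502 * (suc g * Z) + 108 * (suc g * Z))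
      expandʳ = ℕ.solve-∀

    -- The ratio W/Z is t^g, and Bernoulli gives t^g ≥ 1 - g/N = 35/36.
    Z-bound : 35 * Z ≤ 36 * W
    Z-bound = begin
      35 * Z                            ≡⟨ cong (35 *_) (trans (cong (N ^_) (split g)) (ℕ.^-distribˡ-+-* N g (2 * g))) ⟩
      35 * (N ^ g * N ^ (2 * g))        ≡⟨ ℕ.*-assoc 35 (N ^ g) _ ⟨
      35 * N ^ g * N ^ (2 * g)          ≤⟨ ℕ.*-monoˡ-≤ (N ^ (2 * g)) one-step ⟩
      36 * p ^ g * N ^ (2 * g)          ≡⟨ ℕ.*-assoc 36 (p ^ g) _ ⟩
      36 * W                            ∎
      where
      split : ∀ g → 3 * g ≡ g + 2 * g
      split = ℕ.solve-∀
      expandˡ : ∀ g Y → g * (35 * Y + Y) ≡ 36 * g * Y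
      expandˡ = ℕ.solve-∀
      expandʳ : ∀ g X Y → 36 * g * X + g * Y ≡ g * (36 * X + Y)
      expandʳ = ℕ.solve-∀
      one-step : 35 * N ^ g ≤ 36 * p ^ g
      one-step = ℕ.+-cancelʳ-≤ (N ^ g) _ _ (ℕ.*-cancelˡ-≤ g (begin
        g * (35 * N ^ g + N ^ g)        ≡⟨ expandˡ g (N ^ g) ⟩
        36 * g * N ^ g                  ≡⟨ cong (_* N ^ g) N≡36g ⟨
        N * N ^ g                       ≤⟨ bernoulli p g ⟩
        N * p ^ g + g * N ^ g           ≡⟨ cong (λ n → n * p ^ g + g * N ^ g) N≡36g ⟩
        36 * g * p ^ g + g * N ^ g      ≡⟨ expandʳ g (p ^ g) (N ^ g) ⟩
        g * (36 * p ^ g + N ^ g)        ∎))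

    -- The factors 2502/2592 and 36/35 multiply to exactly 139/140. The product is below 1 because
    -- the mean exponent g/2 lies above the threshold g/3 and N is large enough to tame the
    -- quadratic error.
    S-bound : 140 * S ≤ 139 * suc g * W
    S-bound = ℕ.*-cancelˡ-≤ 648 (begin
      648 * (140 * S)             ≡⟨ expandˡ S ⟩
      35 * (2592 * S)             ≤⟨ ℕ.*-monoʳ-≤ 35 S-bound₂ ⟩
      35 * (2502 * (suc g * Z))   ≡⟨ swap (suc g) Z ⟩
      2502 * suc g * (35 * Z)     ≤⟨ ℕ.*-monoʳ-≤ (2502 * suc g) Z-bound ⟩
      2502 * suc g * (36 * W)     ≡⟨ expandʳ (suc g) W ⟩
      648 * (139 * suc g * W)     ∎)
      where
      expandˡ : ∀ S → 648 * (140 * S) ≡ 35 * (2592 * S)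
      expandˡ = ℕ.solve-∀
      swap : ∀ q Z → 35 * (2502 * (q * Z)) ≡ 2502 * q * (35 * Z)
      swap = ℕ.solve-∀
      expandʳ : ∀ q W → 2502 * q * (36 * W) ≡ 648 * (139 * q * W)
      expandʳ = ℕ.solve-∀

    ∏-weight : ∀ {m} (e : Vec ℕ m) → VAll (_≤ g) e → ∃ λ f →
               ∏ (Vec.map weight e) ≡ p ^ (3 * Vec.sum e) * N ^ f × 3 * Vec.sum e + f ≡ 3 * (m * g)
    ∏-weight []       []           = 0 , refl , refl
    ∏-weight {suc m} (a ∷ e) (a≤g ∷ le) with ∏-weight e le
    ... | f , eq , sum≡ = 3 * (g ∸ a) + f , weights , total
      where
      s = Vec.sum e
      weights : weight a * ∏ (Vec.map weight e) ≡ p ^ (3 * (a + s)) * N ^ (3 * (g ∸ a) + f)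
      weights = begin-equality
        weight a * ∏ (Vec.map weight e)                                ≡⟨ cong (weight a *_) eq ⟩
        p ^ (3 * a) * N ^ (3 * (g ∸ a)) * (p ^ (3 * s) * N ^ f)        ≡⟨ *-interchange (p ^ (3 * a)) _ (p ^ (3 * s)) _ ⟩
        p ^ (3 * a) * p ^ (3 * s) * (N ^ (3 * (g ∸ a)) * N ^ f)        ≡⟨ cong₂ _*_ (ℕ.^-distribˡ-+-* p (3 * a) (3 * s)) (ℕ.^-distribˡ-+-* N (3 * (g ∸ a)) f) ⟨
        p ^ (3 * a + 3 * s) * N ^ (3 * (g ∸ a) + f)                    ≡⟨ cong (λ k → p ^ k * N ^ (3 * (g ∸ a) + f)) (ℕ.*-distribˡ-+ 3 a s) ⟨
        p ^ (3 * (a + s)) * N ^ (3 * (g ∸ a) + f)                      ∎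
      shuffle : ∀ a s b f → 3 * (a + s) + (3 * b + f) ≡ 3 * (a + b) + (3 * s + f)
      shuffle = ℕ.solve-∀
      total : 3 * (a + s) + (3 * (g ∸ a) + f) ≡ 3 * (suc m * g)
      total = begin-equality
        3 * (a + s) + (3 * (g ∸ a) + f)      ≡⟨ shuffle a s (g ∸ a) f ⟩
        3 * (a + (g ∸ a)) + (3 * s + f)      ≡⟨ cong₂ (λ x y → 3 * x + y) (ℕ.m+[n∸m]≡n a≤g) sum≡ ⟩
        3 * g + 3 * (m * g)                  ≡⟨ ℕ.*-distribˡ-+ 3 g (m * g) ⟨
        3 * (suc m * g)                      ∎

    -- The product weight depends only on the sum of the exponents and, as `p` is below `N`, does
    -- not increase with it; `W ^ m` is its value at the threshold m g / 3.
    W^m≤ : ∀ {m} (e : Vec ℕ m) → VAll (_≤ g) e → 3 * Vec.sum e ≤ m * g → W ^ m ≤ ∏ (Vec.map weight e)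
    W^m≤ {m} e le low with ∏-weight e le
    ... | f , eq , sum≡ = begin
      W ^ m                                          ≡⟨ W^m≡ m ⟩
      p ^ (m * g) * N ^ (2 * (m * g))                ≡⟨ cong (λ k → p ^ k * N ^ (2 * (m * g))) (ℕ.m+[n∸m]≡n low) ⟨
      p ^ (s + r) * N ^ (2 * (m * g))                ≡⟨ cong (_* N ^ (2 * (m * g))) (ℕ.^-distribˡ-+-* p s r) ⟩
      p ^ s * p ^ r * N ^ (2 * (m * g))              ≤⟨ ℕ.*-monoˡ-≤ (N ^ (2 * (m * g))) (ℕ.*-monoʳ-≤ (p ^ s) (ℕ.^-monoˡ-≤ r (ℕ.n≤1+n p))) ⟩
      p ^ s * N ^ r * N ^ (2 * (m * g))              ≡⟨ ℕ.*-assoc (p ^ s) (N ^ r) _ ⟩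
      p ^ s * (N ^ r * N ^ (2 * (m * g)))            ≡⟨ cong (p ^ s *_) (ℕ.^-distribˡ-+-* N r (2 * (m * g))) ⟨
      p ^ s * N ^ (r + 2 * (m * g))                  ≡⟨ cong (λ k → p ^ s * N ^ k) (ℕ.+-cancelˡ-≡ s _ _ exponent) ⟩
      p ^ s * N ^ f                                  ≡⟨ eq ⟨
      ∏ (Vec.map weight e)                           ∎
      where
      s = 3 * Vec.sum e
      r = m * g ∸ s
      three : ∀ k → k + 2 * k ≡ 3 * k
      three = ℕ.solve-∀
      exponent : s + (r + 2 * (m * g)) ≡ s + f
      exponent = begin-equality
        s + (r + 2 * (m * g))   ≡⟨ ℕ.+-assoc s r _ ⟨
        s + r + 2 * (m * g)     ≡⟨ cong (_+ 2 * (m * g)) (ℕ.m+[n∸m]≡n low) ⟩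
        m * g + 2 * (m * g)     ≡⟨ three (m * g) ⟩
        3 * (m * g)             ≡⟨ sum≡ ⟨
        s + f                   ∎
      W^m≡ : ∀ m → W ^ m ≡ p ^ (m * g) * N ^ (2 * (m * g))
      W^m≡ zero    = refl
      W^m≡ (suc m) = begin-equality
        W * W ^ m                                                       ≡⟨ cong (W *_) (W^m≡ m) ⟩
        p ^ g * N ^ (2 * g) * (p ^ (m * g) * N ^ (2 * (m * g)))         ≡⟨ *-interchange (p ^ g) _ (p ^ (m * g)) _ ⟩
        p ^ g * p ^ (m * g) * (N ^ (2 * g) * N ^ (2 * (m * g)))         ≡⟨ cong₂ _*_ (ℕ.^-distribˡ-+-* p g (m * g)) (ℕ.^-distribˡ-+-* N (2 * g) (2 * (m * g))) ⟨
        p ^ (g + m * g) * N ^ (2 * g + 2 * (m * g))                     ≡⟨ cong (λ k → p ^ (g + m * g) * N ^ k) (ℕ.*-distribˡ-+ 2 g (m * g)) ⟨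
        p ^ (g + m * g) * N ^ (2 * (g + m * g))                         ∎

    -- Markov's inequality for the product weight, whose total over the box factors as `S ^ m`.
    lowDegree-bound : ∀ m → length (lowDegree g m) * 140 ^ m ≤ (139 * suc g) ^ m
    lowDegree-bound m = ℕ.*-cancelʳ-≤ _ _ (W ^ m) {{W^m≢0}} (begin
      l * 140 ^ m * W ^ m            ≡⟨ swap l (140 ^ m) (W ^ m) ⟩
      140 ^ m * (l * W ^ m)          ≤⟨ ℕ.*-monoʳ-≤ (140 ^ m) (length-filter-* _ box λ {e} e∈ low →
                                          W^m≤ e (VAll.map (λ a∈ → s≤s⁻¹ (∈-upTo⁻ a∈)) (∈-tuples⁻ (upTo (suc g)) m e∈)) low) ⟩
      140 ^ m * ∑ box (λ e → ∏ (Vec.map weight e)) ≡⟨ cong (140 ^ m *_) (∑-tuples (upTo (suc g)) weight m) ⟩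
      140 ^ m * S ^ m                ≡⟨ ^-distribʳ-* m 140 S ⟨
      (140 * S) ^ m                  ≤⟨ ℕ.^-monoˡ-≤ m S-bound ⟩
      (139 * suc g * W) ^ m          ≡⟨ ^-distribʳ-* m (139 * suc g) W ⟩
      (139 * suc g) ^ m * W ^ m      ∎)
      where
      box = tuples (upTo (suc g)) m
      l = length (lowDegree g m)
      swap : ∀ a b c → a * b * c ≡ b * (a * c)
      swap = ℕ.solve-∀
      p≢0 : NonZero p
      p≢0 = ℕ.≢-nonZero λ { refl → contradiction (ℕ.m*n≡1⇒m≡1 36 g (sym N≡36g)) λ () }
      W^m≢0 : NonZero (W ^ m)
      W^m≢0 = ℕ.m^n≢0 W m {{ℕ.m*n≢0 (p ^ g) (N ^ (2 * g)) {{ℕ.m^n≢0 p g {{p≢0}}}} {{ℕ.m^n≢0 N (2 * g)}}}}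

-- Affine maps and equidistribution of pairs

module Supersaturation (𝔽 : FiniteField) where
  open FiniteField 𝔽 using (Carrier; 0#; 1#; -_; order; elements; enumeration; isCommutativeRing; 0≢1; inverse)
    renaming (_+_ to _+ᶠ_; _*_ to _*ᶠ_; _≟_ to _≟ᶠ_)
  module F = IsCommutativeRing isCommutativeRing
  open CapSet 𝔽 using (module Solver; ∈-elements; length-elements; _⊕ᵛ_)
  open Counting
  open ℕ∑
  open import Data.Nat.Base using (_+_; _*_)

  private
    V : ℕ → Set
    V = Space 𝔽
    vs : ∀ n → List (V n)
    vs = vectors 𝔽

  _≟ᵛ_ : ∀ {n} → DecidableEquality (V n)
  _≟ᵛ_ = Vec.≡-dec _≟ᶠ_

  2≤order : 2 ≤ order
  2≤order = distinct (Inverse.to enumeration 0#) (Inverse.to enumeration 1#) λ eq → 0≢1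
    (trans (sym (Inverse.strictlyInverseʳ enumeration 0#))
      (trans (cong (Inverse.from enumeration) eq) (Inverse.strictlyInverseʳ enumeration 1#)))
    where
    distinct : ∀ {k} (i j : Fin k) → i ≢ j → 2 ≤ k
    distinct {suc zero}    Fin.zero Fin.zero i≢j = contradiction refl i≢j
    distinct {suc (suc k)} _        _        _   = s≤s (s≤s z≤n)

  vectors≡tuples : ∀ n → vs n ≡ tuples elements n
  vectors≡tuples zero    = refl
  vectors≡tuples (suc n) = cong (cartesianProductWith _∷_ elements) (vectors≡tuples n)

  elements-unique : Unique elements
  elements-unique = Unique.map⁺ (λ {i} {j} eq → trans (sym (Inverse.strictlyInverseˡ enumeration i))
    (trans (cong (Inverse.to enumeration) eq) (Inverse.strictlyInverseˡ enumeration j))) (Unique.allFin⁺ order)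

  vectors-unique : ∀ n → Unique (vs n)
  vectors-unique n = subst Unique (sym (vectors≡tuples n)) (tuples-unique n elements-unique)

  ∈-vectors : ∀ {n} (v : V n) → v ∈ vs n
  ∈-vectors v = subst (v ∈_) (sym (vectors≡tuples _)) (∈-tuples⁺ (VAll.universal ∈-elements v))

  length-tuples : {X : Set} (xs : List X) (m : ℕ) → length (tuples xs m) ≡ length xs ^ m
  length-tuples xs zero    = refl
  length-tuples xs (suc m) = begin
    length (tuples xs (suc m))                ≡⟨ count (tuples xs (suc m)) ⟩
    ∑ (tuples xs (suc m)) (λ _ → 1)           ≡⟨ ∑-cartesianProductWith _∷_ xs (tuples xs m) _ ⟩
    ∑ xs (λ _ → ∑ (tuples xs m) (λ _ → 1))    ≡⟨ ∑-const xs _ ⟩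
    length xs * ∑ (tuples xs m) (λ _ → 1)     ≡⟨ cong (length xs *_) (count (tuples xs m)) ⟨
    length xs * length (tuples xs m)          ≡⟨ cong (length xs *_) (length-tuples xs m) ⟩
    length xs ^ suc m                         ∎
    where
    open ≡-Reasoning
    count : {Y : Set} (ys : List Y) → length ys ≡ ∑ ys (λ _ → 1)
    count ys = sym (trans (∑-const ys 1) (ℕ.*-identityʳ _))

  length-vectors : ∀ n → length (vs n) ≡ order ^ n
  length-vectors n = trans (cong length (vectors≡tuples n))
    (trans (length-tuples elements n) (cong (_^ n) length-elements))

  -- The graph of `f` is summed in both orders: each `x` meets it once, at `f x`, and each `y` once,
  -- at `g y`.
  ∑-bijection : ∀ {n} (f g : V n → V n) → (∀ y → f (g y) ≡ y) → (∀ x → g (f x) ≡ x) →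
                (F : V n → ℕ) → ∑ (vs n) (F ∘ f) ≡ ∑ (vs n) F
  ∑-bijection {n} f g fg gf F = begin
    ∑ (vs n) (F ∘ f)
      ≡⟨ ∑-cong (vs n) (λ {x} _ → sym (∑-indicator _≟ᵛ_ (vectors-unique n) (∈-vectors (f x)) F)) ⟩
    ∑ (vs n) (λ x → ∑ (vs n) (λ y → 𝟙 (f x ≟ᵛ y) * F y))
      ≡⟨ ∑-comm (vs n) (vs n) _ ⟩
    ∑ (vs n) (λ y → ∑ (vs n) (λ x → 𝟙 (f x ≟ᵛ y) * F y))
      ≡⟨ ∑-cong (vs n) (λ {y} _ → trans (∑-single (vectors-unique n) (∈-vectors (g y)) (off y)) (at y)) ⟩
    ∑ (vs n) F ∎
    where
    open ≡-Reasoning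
    off : ∀ y {x} → x ∈ vs n → x ≢ g y → 𝟙 (f x ≟ᵛ y) * F y ≡ 0
    off y {x} _ x≢gy with f x ≟ᵛ y
    ... | yes refl = contradiction (sym (gf x)) x≢gy
    ... | no _     = refl
    at : ∀ y → 𝟙 (f (g y) ≟ᵛ y) * F y ≡ F y
    at y with f (g y) ≟ᵛ y
    ... | yes _ = ℕ.*-identityˡ (F y)
    ... | no ≢y = contradiction (fg y) ≢y

  infixr 8 _·_
  _·_ : ∀ {n} → Carrier → V n → V n
  c · v = Vec.map (c *ᶠ_) v

  infix 8 ⊖_
  ⊖_ : ∀ {n} → V n → V n
  ⊖ v = Vec.map -_ v

  cancel-⊖ : ∀ {n} (u x : V n) → u ⊕ᵛ (⊖ u ⊕ᵛ x) ≡ x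
  cancel-⊖ []      []      = refl
  cancel-⊖ (u ∷ us) (x ∷ xs) = cong₂ _∷_
    (trans (sym (F.+-assoc u (- u) x)) (trans (cong (_+ᶠ x) (F.-‿inverseʳ u)) (F.+-identityˡ x))) (cancel-⊖ us xs)

  ⊖-cancel : ∀ {n} (u x : V n) → ⊖ u ⊕ᵛ (u ⊕ᵛ x) ≡ x
  ⊖-cancel []      []      = refl
  ⊖-cancel (u ∷ us) (x ∷ xs) = cong₂ _∷_
    (trans (sym (F.+-assoc (- u) u x)) (trans (cong (_+ᶠ x) (F.-‿inverseˡ u)) (F.+-identityˡ x))) (⊖-cancel us xs)

  ·-cancel : ∀ {n c d} → c *ᶠ d ≡ 1# → (v : V n) → c · (d · v) ≡ v
  ·-cancel cd≡1 []      = refl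
  ·-cancel {c = c} {d} cd≡1 (v ∷ v′) = cong₂ _∷_
    (trans (sym (F.*-assoc c d v)) (trans (cong (_*ᶠ v) cd≡1) (F.*-identityˡ v))) (·-cancel cd≡1 v′)

  ⊕-comm : ∀ {n} (x y : V n) → x ⊕ᵛ y ≡ y ⊕ᵛ x
  ⊕-comm = Vec.zipWith-comm F.+-comm

  ⊕-exchange : ∀ {n} (x y z : V n) → x ⊕ᵛ (y ⊕ᵛ z) ≡ y ⊕ᵛ (x ⊕ᵛ z)
  ⊕-exchange []      []      []      = refl
  ⊕-exchange (x ∷ xs) (y ∷ ys) (z ∷ zs) = cong₂ _∷_ (lemma x y z) (⊕-exchange xs ys zs)
    where
    open Solver
    lemma : ∀ x y z → x +ᶠ (y +ᶠ z) ≡ y +ᶠ (x +ᶠ z)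
    lemma = solve 3 (λ x y z → x :+ (y :+ z) := y :+ (x :+ z)) refl

  ⊕-interchange : ∀ {n} (x y z w : V n) → (x ⊕ᵛ y) ⊕ᵛ (z ⊕ᵛ w) ≡ (x ⊕ᵛ z) ⊕ᵛ (y ⊕ᵛ w)
  ⊕-interchange []      []      []      []      = refl
  ⊕-interchange (x ∷ xs) (y ∷ ys) (z ∷ zs) (w ∷ ws) = cong₂ _∷_ (lemma x y z w) (⊕-interchange xs ys zs ws)
    where
    open Solver
    lemma : ∀ x y z w → (x +ᶠ y) +ᶠ (z +ᶠ w) ≡ (x +ᶠ z) +ᶠ (y +ᶠ w)
    lemma = solve 4 (λ x y z w → (x :+ y) :+ (z :+ w) := (x :+ z) :+ (y :+ w)) refl

  shear : ∀ {n} (l d : Carrier) (x v w : V n) →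
          x ⊕ᵛ ((l +ᶠ d) · v ⊕ᵛ w) ≡ ((l · v ⊕ᵛ w) ⊕ᵛ x) ⊕ᵛ d · v
  shear l d []      []      []      = refl
  shear l d (x ∷ xs) (v ∷ v′) (w ∷ ws) = cong₂ _∷_ (lemma l d x v w) (shear l d xs v′ ws)
    where
    open Solver
    lemma : ∀ l d x v w → x +ᶠ ((l +ᶠ d) *ᶠ v +ᶠ w) ≡ ((l *ᶠ v +ᶠ w) +ᶠ x) +ᶠ d *ᶠ v
    lemma = solve 5 (λ l d x v w → x :+ ((l :+ d) :* v :+ w) := ((l :* v :+ w) :+ x) :+ d :* v) refl

  ·-distribʳ : ∀ {n} (l k : Carrier) (v : V n) → (l +ᶠ k) · v ≡ l · v ⊕ᵛ k · v
  ·-distribʳ l k []       = refl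
  ·-distribʳ l k (v ∷ v′) = cong₂ _∷_ (F.distribʳ v l k) (·-distribʳ l k v′)

  ∑-translate : ∀ {n} (u : V n) (F : V n → ℕ) → ∑ (vs n) (λ x → F (u ⊕ᵛ x)) ≡ ∑ (vs n) F
  ∑-translate u = ∑-bijection (u ⊕ᵛ_) (⊖ u ⊕ᵛ_) (cancel-⊖ u) (⊖-cancel u)

  ∑-scale : ∀ {n d} → d ≢ 0# → (F : V n → ℕ) → ∑ (vs n) (λ x → F (d · x)) ≡ ∑ (vs n) F
  ∑-scale {d = d} d≢0 = let d⁻¹ , dd⁻¹≡1 = inverse d d≢0 in
    ∑-bijection (d ·_) (d⁻¹ ·_) (·-cancel dd⁻¹≡1) (·-cancel (trans (F.*-comm d⁻¹ d) dd⁻¹≡1))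

  -- The linear map sending the standard basis to `ws`. Together with an origin `o` it describes
  -- every affine map exactly once.
  combination : ∀ {m n} → Vec (V n) m → V m → V n
  combination         []       []       = Vec.replicate _ 0#
  combination         (v ∷ ws) (l ∷ ls) = l · v ⊕ᵛ combination ws ls

  combination-⊕ : ∀ {m n} (ws : Vec (V n) m) (x y : V m) →
                  combination ws (x ⊕ᵛ y) ≡ combination ws x ⊕ᵛ combination ws y
  combination-⊕ []       []      []      = sym (Vec.zipWith-identityˡ F.+-identityˡ _)
  combination-⊕ (v ∷ ws) (x ∷ xs) (y ∷ ys) = trans
    (cong₂ _⊕ᵛ_ (·-distribʳ x y v) (combination-⊕ ws xs ys)) (⊕-interchange (x · v) (y · v) _ _)

  -- In a coordinate where x and y differ, the corresponding direction shears one image point against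
  -- the other; the remaining directions only translate both.
  equidistribution : ∀ {m n} (G : V n → V n → ℕ) (x y : V m) → x ≢ y → let Q = length (vs n) in
    Q * Q * ∑ (tuples (vs n) m) (λ ws → ∑ (vs n) (λ o → G (o ⊕ᵛ combination ws x) (o ⊕ᵛ combination ws y)))
    ≡ Q ^ m * Q * ∑ (vs n) (λ X → ∑ (vs n) (G X))
  equidistribution         G []       []       x≢y = contradiction refl x≢y
  equidistribution {suc m} {n} G (l ∷ x) (k ∷ y) x≢y with x ≟ᵛ y
  ... | no x≢y′ = begin
    Q * Q * ∑ (tuples (vs n) (suc m)) (λ ws → ∑ (vs n) (λ o → G (o ⊕ᵛ combination ws (l ∷ x)) (o ⊕ᵛ combination ws (k ∷ y))))
      ≡⟨ cong (Q * Q *_) (∑-cartesianProductWith _∷_ (vs n) (tuples (vs n) m) _) ⟩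
    Q * Q * ∑ (vs n) (λ v → ∑ (tuples (vs n) m) (λ ws → ∑ (vs n) (λ o →
      G (o ⊕ᵛ (l · v ⊕ᵛ combination ws x)) (o ⊕ᵛ (k · v ⊕ᵛ combination ws y)))))
      ≡⟨ *-distribˡ-∑ (Q * Q) (vs n) _ ⟩
    ∑ (vs n) (λ v → Q * Q * ∑ (tuples (vs n) m) (λ ws → ∑ (vs n) (λ o →
      G (o ⊕ᵛ (l · v ⊕ᵛ combination ws x)) (o ⊕ᵛ (k · v ⊕ᵛ combination ws y)))))
      ≡⟨ ∑-cong (vs n) (λ {v} _ → slice v) ⟩
    ∑ (vs n) (λ v → Q ^ m * Q * ΣG)
      ≡⟨ ∑-const (vs n) (Q ^ m * Q * ΣG) ⟩
    Q * (Q ^ m * Q * ΣG)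
      ≡⟨ assoc Q (Q ^ m) ΣG ⟩
    Q ^ suc m * Q * ΣG ∎
    where
    open ≡-Reasoning
    Q = length (vs n)
    ΣG = ∑ (vs n) (λ X → ∑ (vs n) (G X))
    assoc : ∀ a b c → a * (b * a * c) ≡ a * b * a * c
    assoc = ℕ.solve-∀
    slice : ∀ v → Q * Q * ∑ (tuples (vs n) m) (λ ws → ∑ (vs n) (λ o →
      G (o ⊕ᵛ (l · v ⊕ᵛ combination ws x)) (o ⊕ᵛ (k · v ⊕ᵛ combination ws y)))) ≡ Q ^ m * Q * ΣG
    slice v = begin
      Q * Q * ∑ (tuples (vs n) m) (λ ws → ∑ (vs n) (λ o →
        G (o ⊕ᵛ (l · v ⊕ᵛ combination ws x)) (o ⊕ᵛ (k · v ⊕ᵛ combination ws y))))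
        ≡⟨ cong (Q * Q *_) (∑-cong (tuples (vs n) m) λ _ → ∑-cong (vs n) λ _ →
             cong₂ G (⊕-exchange _ _ _) (⊕-exchange _ _ _)) ⟩
      Q * Q * ∑ (tuples (vs n) m) (λ ws → ∑ (vs n) (λ o →
        G (l · v ⊕ᵛ (o ⊕ᵛ combination ws x)) (k · v ⊕ᵛ (o ⊕ᵛ combination ws y))))
        -- For a fixed direction `v` the two arguments of `G` are merely translated; the induction
        -- hypothesis is applied to the translated function, which is why `G` is arbitrary.
        ≡⟨ equidistribution (λ X Y → G (l · v ⊕ᵛ X) (k · v ⊕ᵛ Y)) x y x≢y′ ⟩
      Q ^ m * Q * ∑ (vs n) (λ X → ∑ (vs n) (λ Y → G (l · v ⊕ᵛ X) (k · v ⊕ᵛ Y)))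
        ≡⟨ cong (Q ^ m * Q *_) (trans (∑-cong (vs n) λ {X} _ → ∑-translate (k · v) (G (l · v ⊕ᵛ X)))
             (∑-translate (l · v) (λ X → ∑ (vs n) (G X)))) ⟩
      Q ^ m * Q * ΣG ∎
  ... | yes refl = begin
    Q * Q * ∑ (tuples (vs n) (suc m)) (λ ws → ∑ (vs n) (λ o → G (o ⊕ᵛ combination ws (l ∷ x)) (o ⊕ᵛ combination ws (k ∷ x))))
      ≡⟨ cong (Q * Q *_) (trans (∑-cartesianProductWith _∷_ (vs n) (tuples (vs n) m) _) (∑-comm (vs n) (tuples (vs n) m) _)) ⟩
    Q * Q * ∑ (tuples (vs n) m) (λ ws → ∑ (vs n) (λ v → ∑ (vs n) (λ o →
      G (o ⊕ᵛ (l · v ⊕ᵛ combination ws x)) (o ⊕ᵛ (k · v ⊕ᵛ combination ws x)))))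
      ≡⟨ cong (Q * Q *_) (∑-cong (tuples (vs n) m) λ {ws} _ → plane (combination ws x)) ⟩
    Q * Q * ∑ (tuples (vs n) m) (λ _ → ΣG)
      ≡⟨ cong (Q * Q *_) (trans (∑-const (tuples (vs n) m) ΣG) (cong (_* ΣG) (length-tuples (vs n) m))) ⟩
    Q * Q * (Q ^ m * ΣG)
      ≡⟨ assoc Q (Q ^ m) ΣG ⟩
    Q ^ suc m * Q * ΣG ∎
    where
    open ≡-Reasoning
    Q = length (vs n)
    ΣG = ∑ (vs n) (λ X → ∑ (vs n) (G X))
    assoc : ∀ a b c → a * a * (b * c) ≡ a * b * a * c
    assoc = ℕ.solve-∀
    d = - l +ᶠ k
    l+d≡k : l +ᶠ d ≡ k
    l+d≡k = trans (sym (F.+-assoc l (- l) k)) (trans (cong (_+ᶠ k) (F.-‿inverseʳ l)) (F.+-identityˡ k))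
    d≢0 : d ≢ 0#
    d≢0 d≡0 = x≢y (cong (_∷ x) (trans (sym (F.+-identityʳ l)) (trans (cong (l +ᶠ_) (sym d≡0)) l+d≡k)))
    plane : ∀ w → ∑ (vs n) (λ v → ∑ (vs n) (λ o → G (o ⊕ᵛ (l · v ⊕ᵛ w)) (o ⊕ᵛ (k · v ⊕ᵛ w)))) ≡ ΣG
    plane w = begin
      ∑ (vs n) (λ v → ∑ (vs n) (λ o → G (o ⊕ᵛ (l · v ⊕ᵛ w)) (o ⊕ᵛ (k · v ⊕ᵛ w))))
        -- With the first image point X as the new origin, the second is X + d v. As `v` varies it
        -- runs through the whole space once, because d ≠ 0.
        ≡⟨ ∑-cong (vs n) (λ {v} _ → ∑-cong (vs n) λ {o} _ → cong₂ G (⊕-comm o _)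
             (trans (cong (λ c → o ⊕ᵛ (c · v ⊕ᵛ w)) (sym l+d≡k)) (shear l d o v w))) ⟩
      ∑ (vs n) (λ v → ∑ (vs n) (λ o → G ((l · v ⊕ᵛ w) ⊕ᵛ o) (((l · v ⊕ᵛ w) ⊕ᵛ o) ⊕ᵛ d · v)))
        ≡⟨ ∑-cong (vs n) (λ {v} _ → ∑-translate (l · v ⊕ᵛ w) (λ X → G X (X ⊕ᵛ d · v))) ⟩
      ∑ (vs n) (λ v → ∑ (vs n) (λ X → G X (X ⊕ᵛ d · v)))
        ≡⟨ ∑-comm (vs n) (vs n) _ ⟩
      ∑ (vs n) (λ X → ∑ (vs n) (λ v → G X (X ⊕ᵛ d · v)))
        ≡⟨ ∑-cong (vs n) (λ {X} _ → trans (∑-scale d≢0 (λ Y → G X (X ⊕ᵛ Y))) (∑-translate X (G X))) ⟩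
      ΣG ∎

-- Averaging over affine maps

module Count (𝔽 : FiniteField) where
  open FiniteField 𝔽 using (order)
  open CapSet 𝔽 using (_⊕ᵛ_; cap-set-bound)
  open Supersaturation 𝔽
  open Counting
  open ℕ∑
  open import Data.Nat.Base using (_+_; _*_)

  private
    V : ℕ → Set
    V = Space 𝔽
    vs : ∀ n → List (V n)
    vs = vectors 𝔽

  term≤∑ : {I : Set} {xs : List I} {a : I} (f : I → ℕ) → a ∈ xs → f a ≤ ∑ xs f
  term≤∑ f (here refl) = ℕ.m≤m+n _ _
  term≤∑ f (there a∈)  = ℕ.≤-trans (term≤∑ f a∈) (ℕ.m≤n+m _ _)

  𝟙≤1 : {P : Set} (P? : Dec P) → 𝟙 P? ≤ 1
  𝟙≤1 (yes _) = ℕ.≤-refl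
  𝟙≤1 (no _)  = z≤n

  𝟙-yes : {P : Set} (P? : Dec P) → P → 𝟙 P? ≡ 1
  𝟙-yes (yes _) _ = refl
  𝟙-yes (no ¬p) p = contradiction p ¬p

  -- A solution is determined by x and z through y = 2z - x. Indexing by this pair brings the count
  -- into the range of pair equidistribution.
  third : ∀ {n} → V n → V n → V n
  third x z = ⊖ x ⊕ᵛ (z ⊕ᵛ z)

  module _ {n} {A : Pred (V n) 0ℓ} (A? : Decidable A) where
    progression : V n → V n → ℕ
    progression x z = 𝟙 (A? x ×-dec A? z ×-dec A? (third x z))

    #progressions : ℕ
    #progressions = ∑ (vs n) (λ x → ∑ (vs n) (progression x))

    #progressions≤#solutions : #progressions ≤ #solutions 𝔽 A?
    #progressions≤#solutions = begin
      ∑ (vs n) (λ x → ∑ (vs n) (progression x))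
        ≤⟨ ∑-mono-≤ (vs n) (λ {x} _ → ∑-mono-≤ (vs n) λ {z} _ → solves x z) ⟩
      ∑ (vs n) (λ x → ∑ (vs n) (λ z → ∑ (vs n) (λ y → 𝟙 (solution? 𝔽 A? (x , y , z)))))
        ≡⟨ ∑-cong (vs n) (λ _ → ∑-comm (vs n) (vs n) _) ⟩
      ∑ (vs n) (λ x → ∑ (vs n) (λ y → ∑ (vs n) (λ z → 𝟙 (solution? 𝔽 A? (x , y , z)))))
        ≡⟨ ∑-cong (vs n) (λ _ → ∑-cartesianProductWith _,_ (vs n) (vs n) _) ⟨
      ∑ (vs n) (λ x → ∑ (cartesianProduct (vs n) (vs n)) (λ yz → 𝟙 (solution? 𝔽 A? (x , yz))))
        ≡⟨ ∑-cartesianProductWith _,_ (vs n) (cartesianProduct (vs n) (vs n)) _ ⟨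
      ∑ (cartesianProduct (vs n) (cartesianProduct (vs n) (vs n))) (λ t → 𝟙 (solution? 𝔽 A? t))
        ≡⟨ length-filter-≡ (solution? 𝔽 A?) (cartesianProduct (vs n) (cartesianProduct (vs n) (vs n))) ⟨
      #solutions 𝔽 A? ∎
      where
      open ℕ.≤-Reasoning
      solves : ∀ x z → progression x z ≤ ∑ (vs n) (λ y → 𝟙 (solution? 𝔽 A? (x , y , z)))
      solves x z with A? x ×-dec A? z ×-dec A? (third x z)
      ... | no _ = z≤n
      ... | yes (ax , az , ay) = subst (_≤ ∑ (vs n) (λ y → 𝟙 (solution? 𝔽 A? (x , y , z))))
        (𝟙-yes (solution? 𝔽 A? (x , third x z , z)) ((ax , ay , az) , cancel-⊖ x (z ⊕ᵛ z)))
        (term≤∑ (λ y → 𝟙 (solution? 𝔽 A? (x , y , z))) (∈-vectors (third x z)))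

    module _ (m : ℕ) where
      private
        Q = length (vs n)
        q^m = length (vs m)
        T = 3 * length (lowDegree (order ∸ 1) m)
        Ws = tuples (vs n) m

      point : Vec (V n) m → V n → V m → V n
      point ws o x = o ⊕ᵛ combination ws x

      nontrivial : V m → V m → ℕ
      nontrivial x z = 𝟙 (¬? (x ≟ᵛ z))

      pullback : Vec (V n) m → V n → ℕ
      pullback ws o = ∑ (vs m) (λ x → 𝟙 (A? (point ws o x)))

      -- Only the points x and z of the source must differ; their images may coincide, and then a
      -- trivial solution in `A` is counted.
      found : Vec (V n) m → V n → ℕ
      found ws o = ∑ (vs m) (λ x → ∑ (vs m) (λ z → nontrivial x z * progression (point ws o x) (point ws o z)))

      -- If nothing is found, the pullback has no progression with x ≠ z and the cap set bound
      -- applies; otherwise the size of the whole source is a bound. Stating both cases as one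
      -- linear inequality allows averaging.
      pullback-bound : ∀ ws o → pullback ws o ≤ T + q^m * found ws o
      pullback-bound ws o with found ws o in found≡
      ... | suc f = begin
        pullback ws o        ≤⟨ ∑-mono-≤ (vs m) (λ _ → 𝟙≤1 (A? _)) ⟩
        ∑ (vs m) (λ _ → 1)   ≡⟨ ∑-const (vs m) 1 ⟩
        q^m * 1              ≤⟨ ℕ.*-monoʳ-≤ q^m (s≤s z≤n) ⟩
        q^m * suc f          ≤⟨ ℕ.m≤n+m _ T ⟩
        T + q^m * suc f      ∎
        where open ℕ.≤-Reasoning
      ... | zero = begin
        pullback ws o        ≡⟨ length-filter-≡ B? (vs m) ⟨
        length B             ≤⟨ cap-set-bound B (Unique.filter⁺ B? (vectors-unique m)) trivial ⟩
        T                    ≤⟨ ℕ.m≤m+n T _ ⟩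
        T + q^m * 0          ∎
        where
        open ℕ.≤-Reasoning
        B? = λ x → A? (point ws o x)
        B = filter B? (vs m)
        in-A : ∀ {x} → x ∈ B → A (point ws o x)
        in-A x∈ = proj₂ (∈-filter⁻ B? {xs = vs m} x∈)
        trivial : ∀ {x y z} → x ∈ B → y ∈ B → z ∈ B → x ⊕ᵛ y ≡ z ⊕ᵛ z → x ≡ z
        trivial {x} {y} {z} x∈ y∈ z∈ eq = decidable-stable (x ≟ᵛ z) λ x≢z → ℕ.1+n≰n (begin
          1                                 ≡⟨ cong₂ _*_ (𝟙-yes (¬? (x ≟ᵛ z)) x≢z)
                                                 (𝟙-yes (A? X ×-dec A? Z ×-dec A? (third X Z))
                                                   (in-A x∈ , in-A z∈ , subst A y≡third (in-A y∈))) ⟨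
          nontrivial x z * progression X Z  ≤⟨ term≤∑ (λ z → nontrivial x z * progression X (point ws o z)) (∈-vectors z) ⟩
          ∑ (vs m) (λ z → nontrivial x z * progression X (point ws o z))
                                            ≤⟨ term≤∑ (λ x → ∑ (vs m) (λ z → nontrivial x z * progression (point ws o x) (point ws o z))) (∈-vectors x) ⟩
          found ws o                        ≡⟨ found≡ ⟩
          0                                 ∎)
          where
          X = point ws o x
          Y = point ws o y
          Z = point ws o z
          sums : X ⊕ᵛ Y ≡ Z ⊕ᵛ Z
          sums = trans (⊕-interchange o _ o _) (trans (cong ((o ⊕ᵛ o) ⊕ᵛ_)
            (trans (sym (combination-⊕ ws x y)) (trans (cong (combination ws) eq) (combination-⊕ ws z z))))
            (⊕-interchange o o _ _))
          y≡third : Y ≡ third X Z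
          y≡third = trans (sym (⊖-cancel X Y)) (cong (⊖ X ⊕ᵛ_) sums)

      -- For fixed `ws` and `x`, the image point is a translate of the origin `o`, so it passes
      -- through each point of `A` once.
      ∑-pullback : ∑ Ws (λ ws → ∑ (vs n) (pullback ws)) ≡ Q ^ m * (q^m * card 𝔽 A?)
      ∑-pullback = begin
        ∑ Ws (λ ws → ∑ (vs n) (λ o → ∑ (vs m) (λ x → 𝟙 (A? (point ws o x)))))
          ≡⟨ ∑-cong Ws (λ {ws} _ → slice ws) ⟩
        ∑ Ws (λ _ → q^m * card 𝔽 A?)
          ≡⟨ ∑-const Ws _ ⟩
        length Ws * (q^m * card 𝔽 A?)
          ≡⟨ cong (_* (q^m * card 𝔽 A?)) (length-tuples (vs n) m) ⟩
        Q ^ m * (q^m * card 𝔽 A?) ∎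
        where
        open ≡-Reasoning
        slice : ∀ ws → ∑ (vs n) (pullback ws) ≡ q^m * card 𝔽 A?
        slice ws = begin
          ∑ (vs n) (λ o → ∑ (vs m) (λ x → 𝟙 (A? (point ws o x))))
            ≡⟨ ∑-comm (vs n) (vs m) _ ⟩
          ∑ (vs m) (λ x → ∑ (vs n) (λ o → 𝟙 (A? (point ws o x))))
            ≡⟨ ∑-cong (vs m) (λ {x} _ → trans
                 (∑-cong (vs n) λ {o} _ → cong (λ v → 𝟙 (A? v)) (⊕-comm o (combination ws x)))
                 (∑-translate (combination ws x) (λ v → 𝟙 (A? v)))) ⟩
          ∑ (vs m) (λ _ → ∑ (vs n) (λ v → 𝟙 (A? v)))
            ≡⟨ ∑-const (vs m) _ ⟩
          q^m * ∑ (vs n) (λ v → 𝟙 (A? v))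
            ≡⟨ cong (q^m *_) (length-filter-≡ A? (vs n)) ⟨
          q^m * card 𝔽 A? ∎

      -- Each of the at most q^(2m) pairs with x ≠ z is equidistributed and thus contributes the
      -- average of `progression` over all pairs.
      ∑-found : Q * Q * ∑ Ws (λ ws → ∑ (vs n) (found ws)) ≤ q^m * (q^m * (Q ^ m * Q * #progressions))
      ∑-found = begin
        Q * Q * ∑ Ws (λ ws → ∑ (vs n) (found ws))
          ≡⟨ cong (Q * Q *_) exchange ⟩
        Q * Q * ∑ (vs m) (λ x → ∑ (vs m) (λ z → nontrivial x z * average x z))
          ≡⟨ trans (*-distribˡ-∑ (Q * Q) (vs m) _) (∑-cong (vs m) λ _ → *-distribˡ-∑ (Q * Q) (vs m) _) ⟩
        ∑ (vs m) (λ x → ∑ (vs m) (λ z → Q * Q * (nontrivial x z * average x z)))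
          ≤⟨ ∑-mono-≤ (vs m) (λ {x} _ → ∑-mono-≤ (vs m) λ {z} _ → each x z) ⟩
        ∑ (vs m) (λ _ → ∑ (vs m) (λ _ → Q ^ m * Q * #progressions))
          ≡⟨ trans (∑-const (vs m) _) (cong (q^m *_) (∑-const (vs m) _)) ⟩
        q^m * (q^m * (Q ^ m * Q * #progressions)) ∎
        where
        open ℕ.≤-Reasoning
        average : V m → V m → ℕ
        average x z = ∑ Ws (λ ws → ∑ (vs n) (λ o → progression (point ws o x) (point ws o z)))

        exchange : ∑ Ws (λ ws → ∑ (vs n) (found ws)) ≡ ∑ (vs m) (λ x → ∑ (vs m) (λ z → nontrivial x z * average x z))
        exchange = begin-equality
          ∑ Ws (λ ws → ∑ (vs n) (λ o → ∑ (vs m) (λ x → ∑ (vs m) (λ z → f ws o x z))))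
            ≡⟨ ∑-cong Ws (λ {ws} _ → ∑-comm (vs n) (vs m) _) ⟩
          ∑ Ws (λ ws → ∑ (vs m) (λ x → ∑ (vs n) (λ o → ∑ (vs m) (λ z → f ws o x z))))
            ≡⟨ ∑-comm Ws (vs m) _ ⟩
          ∑ (vs m) (λ x → ∑ Ws (λ ws → ∑ (vs n) (λ o → ∑ (vs m) (λ z → f ws o x z))))
            ≡⟨ ∑-cong (vs m) (λ {x} _ → trans (∑-cong Ws λ _ → ∑-comm (vs n) (vs m) _) (∑-comm Ws (vs m) _)) ⟩
          ∑ (vs m) (λ x → ∑ (vs m) (λ z → ∑ Ws (λ ws → ∑ (vs n) (λ o → f ws o x z))))
            ≡⟨ ∑-cong (vs m) (λ {x} _ → ∑-cong (vs m) λ {z} _ → trans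
                 (∑-cong Ws λ _ → sym (*-distribˡ-∑ (nontrivial x z) (vs n) _))
                 (sym (*-distribˡ-∑ (nontrivial x z) Ws _))) ⟩
          ∑ (vs m) (λ x → ∑ (vs m) (λ z → nontrivial x z * average x z)) ∎
          where
          f : Vec (V n) m → V n → V m → V m → ℕ
          f ws o x z = nontrivial x z * progression (point ws o x) (point ws o z)

        each : ∀ x z → Q * Q * (nontrivial x z * average x z) ≤ Q ^ m * Q * #progressions
        each x z with x ≟ᵛ z
        ... | yes _ = ℕ.≤-trans (ℕ.≤-reflexive (ℕ.*-zeroʳ (Q * Q))) z≤n
        ... | no x≢z = begin
          Q * Q * (1 * average x z)    ≡⟨ cong (Q * Q *_) (ℕ.*-identityˡ _) ⟩
          Q * Q * average x z          ≡⟨ equidistribution progression x z x≢z ⟩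
          Q ^ m * Q * #progressions    ∎

      -- `pullback-bound` summed over all affine maps. With α = |A|/Q and σ = `#progressions`/Q² it
      -- reads α ≤ T/q^m + q^(2m) σ.
      averaged : Q * (q^m * card 𝔽 A?) ≤ Q * Q * T + q^m * (q^m * (q^m * #progressions))
      averaged = ℕ.*-cancelˡ-≤ (Q ^ m * Q) {{nonzero}} (begin
        Q ^ m * Q * (Q * (q^m * a))                       ≡⟨ expandˡ (Q ^ m) Q (q^m * a) ⟩
        Q * Q * (Q ^ m * (q^m * a))                       ≡⟨ cong (Q * Q *_) ∑-pullback ⟨
        Q * Q * ∑ Ws (λ ws → ∑ (vs n) (pullback ws))      ≤⟨ ℕ.*-monoʳ-≤ (Q * Q) (∑-mono-≤ Ws λ {ws} _ → ∑-mono-≤ (vs n) λ {o} _ → pullback-bound ws o) ⟩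
        Q * Q * ∑ Ws (λ ws → ∑ (vs n) (λ o → T + q^m * found ws o))
                                                          ≡⟨ cong (Q * Q *_) split ⟩
        Q * Q * (Q ^ m * (Q * T) + q^m * F)               ≡⟨ expand (Q ^ m) Q T q^m F ⟩
        Q ^ m * Q * (Q * Q * T) + q^m * (Q * Q * F)       ≤⟨ ℕ.+-monoʳ-≤ (Q ^ m * Q * (Q * Q * T)) (ℕ.*-monoʳ-≤ q^m ∑-found) ⟩
        Q ^ m * Q * (Q * Q * T) + q^m * (q^m * (q^m * (Q ^ m * Q * #progressions)))
                                                          ≡⟨ collect (Q ^ m * Q) (Q * Q * T) q^m #progressions ⟩
        Q ^ m * Q * (Q * Q * T + q^m * (q^m * (q^m * #progressions))) ∎)
        where
        open ℕ.≤-Reasoning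
        a = card 𝔽 A?
        F = ∑ Ws (λ ws → ∑ (vs n) (found ws))
        Q≢0 : NonZero Q
        Q≢0 = subst NonZero (sym (length-vectors n)) (ℕ.m^n≢0 order n {{ℕ.>-nonZero (ℕ.<-trans (s≤s z≤n) 2≤order)}})
        nonzero : NonZero (Q ^ m * Q)
        nonzero = ℕ.m*n≢0 (Q ^ m) Q {{ℕ.m^n≢0 Q m {{Q≢0}}}} {{Q≢0}}
        expandˡ : ∀ x y z → x * y * (y * z) ≡ y * y * (x * z)
        expandˡ = ℕ.solve-∀
        expand : ∀ x y t k f → y * y * (x * (y * t) + k * f) ≡ x * y * (y * y * t) + k * (y * y * f)
        expand = ℕ.solve-∀
        collect : ∀ x y k s → x * y + k * (k * (k * (x * s))) ≡ x * (y + k * (k * (k * s)))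
        collect = ℕ.solve-∀
        split : ∑ Ws (λ ws → ∑ (vs n) (λ o → T + q^m * found ws o)) ≡ Q ^ m * (Q * T) + q^m * F
        split = begin-equality
          ∑ Ws (λ ws → ∑ (vs n) (λ o → T + q^m * found ws o))
            ≡⟨ ∑-cong Ws (λ {ws} _ → trans (∑-distrib-+ (vs n) (λ _ → T) (λ o → q^m * found ws o))
                 (cong₂ _+_ (∑-const (vs n) T) (sym (*-distribˡ-∑ q^m (vs n) (found ws))))) ⟩
          ∑ Ws (λ ws → Q * T + q^m * ∑ (vs n) (found ws))
            ≡⟨ ∑-distrib-+ Ws (λ _ → Q * T) (λ ws → q^m * ∑ (vs n) (found ws)) ⟩
          ∑ Ws (λ _ → Q * T) + ∑ Ws (λ ws → q^m * ∑ (vs n) (found ws))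
            ≡⟨ cong₂ _+_ (trans (∑-const Ws (Q * T)) (cong (_* (Q * T)) (length-tuples (vs n) m)))
                 (sym (*-distribˡ-∑ q^m Ws _)) ⟩
          Q ^ m * (Q * T) + q^m * F ∎

  -- (140/139)^140 ≥ 2, so in dimension 140 k the cap set bound saves a factor 2^k.
  lowDegree-saving : ∀ k → 2 ^ k * length (lowDegree (order ∸ 1) (140 * k)) ≤ order ^ (140 * k)
  lowDegree-saving k = ℕ.*-cancelʳ-≤ _ _ (139 ^ m) {{ℕ.m^n≢0 139 m}} (begin
    2 ^ k * l * 139 ^ m               ≡⟨ swap (2 ^ k) l (139 ^ m) ⟩
    l * (2 ^ k * 139 ^ m)             ≡⟨ cong (λ x → l * (2 ^ k * x)) (ℕ.^-*-assoc 139 140 k) ⟨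
    l * (2 ^ k * (139 ^ 140) ^ k)     ≡⟨ cong (l *_) (^-distribʳ-* k 2 (139 ^ 140)) ⟨
    l * (2 * 139 ^ 140) ^ k           ≤⟨ ℕ.*-monoʳ-≤ l (ℕ.^-monoˡ-≤ k (ℕ.≤ᵇ⇒≤ (2 * 139 ^ 140) (140 ^ 140) _)) ⟩
    l * (140 ^ 140) ^ k               ≡⟨ cong (l *_) (ℕ.^-*-assoc 140 140 k) ⟩
    l * 140 ^ m                       ≤⟨ Chernoff.lowDegree-bound g (ℕ.pred (36 * g)) {{g≢0}} (ℕ.suc-pred (36 * g) {{ℕ.m*n≢0 36 g {{_}} {{g≢0}}}}) m ⟩
    (139 * suc g) ^ m                 ≡⟨ cong (λ q → (139 * q) ^ m) (ℕ.m+[n∸m]≡n (ℕ.<⇒≤ 2≤order)) ⟩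
    (139 * order) ^ m                 ≡⟨ ^-distribʳ-* m 139 order ⟩
    139 ^ m * order ^ m               ≡⟨ ℕ.*-comm (139 ^ m) _ ⟩
    order ^ m * 139 ^ m               ∎)
    where
    open ℕ.≤-Reasoning
    m = 140 * k
    g = order ∸ 1
    l = length (lowDegree g m)
    g≢0 : NonZero g
    g≢0 = ℕ.>-nonZero (ℕ.m<n⇒0<n∸m 2≤order)
    swap : ∀ a b c → a * b * c ≡ b * (a * c)
    swap = ℕ.solve-∀

  -- The dimension is chosen so that the cap set term in `averaged` takes at most half of the
  -- density. The other half leaves σ ≥ α/(2 q^(2m)), and 2 ≤ q turns the factor 2^(E + 1) into a
  -- power of q.
  many-solutions : ∀ {n} {A : Pred (V n) 0ℓ} (A? : Decidable A) (E : ℕ) →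
    order ^ n ≤ 2 ^ E * card 𝔽 A? →
    order ^ n * order ^ n ≤ order ^ (suc E + 2 * (140 * (3 + E))) * #solutions 𝔽 A?
  many-solutions {n} A? E dense = begin
    Q * Q                                         ≤⟨ ℕ.*-monoʳ-≤ Q dense ⟩
    Q * (2 ^ E * a)                               ≡⟨ swap Q (2 ^ E) a ⟩
    2 ^ E * (Q * a)                               ≤⟨ ℕ.*-monoʳ-≤ (2 ^ E) Qa≤ ⟩
    2 ^ E * (2 * (r * (r * s)))                   ≡⟨ regroup (2 ^ E) r s ⟩
    2 ^ suc E * (r * r) * s                       ≤⟨ ℕ.*-mono-≤ (ℕ.*-monoˡ-≤ (r * r) (ℕ.^-monoˡ-≤ (suc E) 2≤order)) (#progressions≤#solutions A?) ⟩
    order ^ suc E * (r * r) * #solutions 𝔽 A?     ≡⟨ cong (_* #solutions 𝔽 A?) powers ⟩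
    order ^ (suc E + 2 * m) * #solutions 𝔽 A?     ∎
    where
    open ℕ.≤-Reasoning
    -- Three extra doublings cover the factor 6 of `l` in `2 * T`, one 2 for the halving and one 3
    -- from the slice rank bound.
    k = 3 + E
    m = 140 * k
    Q = order ^ n
    r = order ^ m
    a = card 𝔽 A?
    s = #progressions A?
    l = length (lowDegree (order ∸ 1) m)
    T = 3 * l
    r≢0 : NonZero r
    r≢0 = ℕ.m^n≢0 order m {{ℕ.>-nonZero (ℕ.<-trans (s≤s z≤n) 2≤order)}}

    swap : ∀ a b c → a * (b * c) ≡ b * (a * c)
    swap = ℕ.solve-∀
    regroup : ∀ e r s → e * (2 * (r * (r * s))) ≡ 2 * e * (r * r) * s
    regroup = ℕ.solve-∀
    powers : order ^ suc E * (r * r) ≡ order ^ (suc E + 2 * m)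
    powers = begin-equality
      order ^ suc E * (r * r)           ≡⟨ cong (order ^ suc E *_) (ℕ.^-distribˡ-+-* order m m) ⟨
      order ^ suc E * order ^ (m + m)   ≡⟨ ℕ.^-distribˡ-+-* order (suc E) (m + m) ⟨
      order ^ (suc E + (m + m))         ≡⟨ cong (λ x → order ^ (suc E + (m + x))) (ℕ.+-identityʳ m) ⟨
      order ^ (suc E + 2 * m)           ∎

    averaged′ : Q * (r * a) ≤ Q * Q * T + r * (r * (r * s))
    averaged′ = subst₂ (λ Q r → Q * (r * a) ≤ Q * Q * T + r * (r * (r * s)))
      (length-vectors n) (length-vectors m) (averaged A? m)

    2^E*2T≤r : 2 ^ E * (2 * T) ≤ r
    2^E*2T≤r = begin
      2 ^ E * (2 * (3 * l))               ≤⟨ ℕ.m≤m+n _ (2 ^ E * (2 * l)) ⟩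
      2 ^ E * (2 * (3 * l)) + 2 ^ E * (2 * l) ≡⟨ eight (2 ^ E) l ⟩
      2 ^ k * l                           ≤⟨ lowDegree-saving k ⟩
      r                                   ∎
      where
      eight : ∀ e l → e * (2 * (3 * l)) + e * (2 * l) ≡ 2 * (2 * (2 * e)) * l
      eight = ℕ.solve-∀

    Qa≤ : Q * a ≤ 2 * (r * (r * s))
    Qa≤ = ℕ.*-cancelˡ-≤ r {{r≢0}} (ℕ.+-cancelˡ-≤ (Q * (r * a)) _ _ (begin
      Q * (r * a) + r * (Q * a)                              ≡⟨ double Q r a ⟩
      2 * (Q * (r * a))                                      ≤⟨ ℕ.*-monoʳ-≤ 2 averaged′ ⟩
      2 * (Q * Q * T + r * (r * (r * s)))                    ≡⟨ expand Q T r s ⟩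
      Q * (Q * (2 * T)) + r * (2 * (r * (r * s)))            ≤⟨ ℕ.+-monoˡ-≤ _ (ℕ.*-monoʳ-≤ Q (begin
        Q * (2 * T)               ≤⟨ ℕ.*-monoˡ-≤ (2 * T) dense ⟩
        2 ^ E * a * (2 * T)       ≡⟨ regroup′ (2 ^ E) a (2 * T) ⟩
        2 ^ E * (2 * T) * a       ≤⟨ ℕ.*-monoˡ-≤ a 2^E*2T≤r ⟩
        r * a                     ∎)) ⟩
      Q * (r * a) + r * (2 * (r * (r * s)))                  ∎))
      where
      double : ∀ Q r a → Q * (r * a) + r * (Q * a) ≡ 2 * (Q * (r * a))
      double = ℕ.solve-∀
      expand : ∀ Q T r s → 2 * (Q * Q * T + r * (r * (r * s))) ≡ Q * (Q * (2 * T)) + r * (2 * (r * (r * s)))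
      expand = ℕ.solve-∀
      regroup′ : ∀ a b c → a * b * c ≡ a * c * b
      regroup′ = ℕ.solve-∀

-- From counts to inequalities between cuts

open import Algebra.Definitions.RawSemiring ℚ.+-*-rawSemiring using () renaming (_^_ to _^ℚ_)

module ℚSolver = NaturalCoefficients (CommutativeRing.commutativeSemiring ℚ.+-*-commutativeRing)

ι : ℕ → ℚ
ι n = fromℤ (ℤ.+ n)

fromℤ-mono-< : ∀ {i j} → i ℤ.< j → fromℤ i ℚ.< fromℤ j
fromℤ-mono-< {i} {j} i<j = ℚ.*<* (subst₂ ℤ._<_ (sym (ℤ.*-identityʳ i)) (sym (ℤ.*-identityʳ j)) i<j)

ι-mono-< : ∀ {m n} → m < n → ι m ℚ.< ι n
ι-mono-< m<n = fromℤ-mono-< (ℤ.+<+ m<n)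

ι-mono-≤ : ∀ {m n} → m ≤ n → ι m ℚ.≤ ι n
ι-mono-≤ {m} {n} m≤n = ℚ.*≤* (subst₂ ℤ._≤_ (sym (ℤ.*-identityʳ (ℤ.+ m))) (sym (ℤ.*-identityʳ (ℤ.+ n))) (ℤ.+≤+ m≤n))

0≤ι : ∀ n → 0ℚ ℚ.≤ ι n
0≤ι n = ι-mono-≤ {0} {n} z≤n

ι-* : ∀ m n → ι (m ℕ.* n) ≡ ι m ℚ.* ι n
ι-* m n = ℚ.toℚᵘ-injective (ℚᵘ.≃-trans
  (ℚᵘ.*≡* (cong (ℤ._* ℤ.+ 1) (ℤ.pos-* m n)))
  (ℚᵘ.≃-sym (ℚ.toℚᵘ-homo-* (ι m) (ι n))))

ι-^ : ∀ b k → ι (b ^ k) ≡ ι b ^ℚ k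
ι-^ b zero    = refl
ι-^ b (suc k) = trans (ι-* b (b ^ k)) (cong (ι b ℚ.*_) (ι-^ b k))

*-monoˡ-≤ : ∀ {p q r} → 0ℚ ℚ.≤ r → p ℚ.≤ q → r ℚ.* p ℚ.≤ r ℚ.* q
*-monoˡ-≤ {r = r} 0≤r = ℚ.*-monoˡ-≤-nonNeg r {{ℚ.nonNegative 0≤r}}

*-monoʳ-≤ : ∀ {p q r} → 0ℚ ℚ.≤ r → p ℚ.≤ q → p ℚ.* r ℚ.≤ q ℚ.* r
*-monoʳ-≤ {r = r} 0≤r = ℚ.*-monoʳ-≤-nonNeg r {{ℚ.nonNegative 0≤r}}

*-mono-<-nonNeg : ∀ {p p′ r r′} → 0ℚ ℚ.≤ p → 0ℚ ℚ.≤ r → p ℚ.< p′ → r ℚ.< r′ → p ℚ.* r ℚ.< p′ ℚ.* r′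
*-mono-<-nonNeg {p} {p′} {r} {r′} 0≤p 0≤r p<p′ r<r′ = ℚ.≤-<-trans (*-monoˡ-≤ 0≤p (ℚ.<⇒≤ r<r′))
  (ℚ.*-monoˡ-<-pos r′ {{ℚ.positive (ℚ.≤-<-trans 0≤r r<r′)}} p<p′)

0≤* : ∀ {p q} → 0ℚ ℚ.≤ p → 0ℚ ℚ.≤ q → 0ℚ ℚ.≤ p ℚ.* q
0≤* {p} {q} 0≤p 0≤q = subst (ℚ._≤ p ℚ.* q) (ℚ.*-zeroʳ p) (*-monoˡ-≤ 0≤p 0≤q)

0≤^ : ∀ {p} → 0ℚ ℚ.≤ p → ∀ k → 0ℚ ℚ.≤ p ^ℚ k
0≤^ 0≤p zero    = 0≤ι 1
0≤^ 0≤p (suc k) = 0≤* 0≤p (0≤^ 0≤p k)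

1<^ : ∀ {p} → 1ℚ ℚ.< p → ∀ k → 1ℚ ℚ.< p ^ℚ suc k
1<^ {p} 1<p zero    = subst (1ℚ ℚ.<_) (sym (ℚ.*-identityʳ p)) 1<p
1<^ {p} 1<p (suc k) = *-mono-<-nonNeg (0≤ι 1) (0≤ι 1) 1<p (1<^ 1<p k)

^-distrib-* : ∀ p q k → (p ℚ.* q) ^ℚ k ≡ p ^ℚ k ℚ.* q ^ℚ k
^-distrib-* p q zero    = refl
^-distrib-* p q (suc k) = trans (cong (p ℚ.* q ℚ.*_) (^-distrib-* p q k))
  (solve 4 (λ a b c d → a :* b :* (c :* d) := a :* c :* (b :* d)) refl p q (p ^ℚ k) (q ^ℚ k))
  where open ℚSolver

L-lower : ∀ (x : ℝ) {p q} → p ℚ.≤ q → L x q → L x p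
L-lower x {p} {q} p≤q xq = let r , q<r , xr = ℝ.open′ x xq in ℝ.lower x (ℚ.≤-<-trans p≤q q<r) xr

L-bound : ∀ (x : ℝ) {p q} → L x p → ¬ L x q → p ℚ.≤ q
L-bound x {p} {q} xp ¬xq = ℚ.≮⇒≥ λ q<p → ¬xq (ℝ.lower x q<p xp)

-- Openness of the cuts provides larger factors p′ and r′. All being non-negative, p′ r′ is the
-- least corner of the box that they span with any upper bounds, and it exceeds p r.
L-* : ∀ (x y : ℝ) {p r} → 0ℚ ℚ.≤ p → 0ℚ ℚ.≤ r → L x p → L y r → L (x *ℝ y) (p ℚ.* r)
L-* x y {p} {r} 0≤p 0≤r xp yr with ℝ.open′ x xp | ℝ.open′ y yr | ℝ.proper x | ℝ.proper y
... | p′ , p<p′ , xp′ | r′ , r<r′ , yr′ | b , ¬xb | d , ¬yd =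
    p′ , b , r′ , d , xp′ , ¬xb , yr′ , ¬yd , pr< , ℚ.<-≤-trans pr< p′r′≤p′d ,
    ℚ.<-≤-trans pr< (*-monoʳ-≤ 0≤r′ p′≤b) ,
    ℚ.<-≤-trans pr< (ℚ.≤-trans p′r′≤p′d (*-monoʳ-≤ (ℚ.≤-trans 0≤r′ r′≤d) p′≤b))
  where
  pr< = *-mono-<-nonNeg 0≤p 0≤r p<p′ r<r′
  0≤p′ = ℚ.≤-trans 0≤p (ℚ.<⇒≤ p<p′)
  0≤r′ = ℚ.≤-trans 0≤r (ℚ.<⇒≤ r<r′)
  p′≤b = L-bound x xp′ ¬xb
  r′≤d = L-bound y yr′ ¬yd
  p′r′≤p′d = *-monoˡ-≤ 0≤p′ r′≤d

-- The additional factor ½ pays for the base case, since 1 is not a member of its own open cut.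
L-^ : ∀ (x : ℝ) → L x ½ → ∀ k → L (x ^ⁿ k) (½ ^ℚ suc k)
L-^ x x½ zero    = ℚ.*<* (ℤ.+<+ (s≤s (s≤s z≤n)))
L-^ x x½ (suc k) = L-* x (x ^ⁿ k) 0≤½ (0≤^ 0≤½ (suc k)) x½ (L-^ x x½ k)
  where 0≤½ = ℚ.nonNegative⁻¹ ½

-- By convexity: N lies between the endpoints a and b of the first side of the box.
L-fromℕ-* : ∀ N (y : ℝ) {p} → L (fromℕ N *ℝ y) p → ∃ λ c → L y c × p ℚ.< ι N ℚ.* c
L-fromℕ-* N y {p} (a , b , c , _ , a<N , b≮N , yc , _ , p<ac , _ , p<bc , _) = c , yc , below
  where
  below : p ℚ.< ι N ℚ.* c
  below with ℚ.≤-total 0ℚ c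
  ... | inj₁ 0≤c = ℚ.<-≤-trans p<ac (*-monoʳ-≤ 0≤c (ℚ.<⇒≤ a<N))
  ... | inj₂ c≤0 = ℚ.<-≤-trans p<bc (ℚ.*-monoʳ-≤-nonPos c {{ℚ.nonPositive c≤0}} (ℚ.≮⇒≥ b≮N))

-‿involutive : ∀ p → ℚ.- (ℚ.- p) ≡ p
-‿involutive = RingProperties.-‿involutive (CommutativeRing.ring ℚ.+-*-commutativeRing)

<-suc-numerator : ∀ q → q ℚ.< ι (suc ℤ.∣ ↥ q ∣)
<-suc-numerator (ℚ.mkℚ (ℤ.+ n) d _) = ℚ.*<* (subst₂ ℤ._<_
  (sym (ℤ.*-identityʳ (ℤ.+ n))) (ℤ.pos-* (suc n) (suc d)) (ℤ.+<+ (ℕ.m≤m*n (suc n) (suc d))))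
<-suc-numerator (ℚ.mkℚ ℤ.-[1+ n ] d _) = ℚ.*<* (subst₂ ℤ._<_ (sym (ℤ.*-identityʳ ℤ.-[1+ n ])) refl ℤ.-<+)

-- Only doubly negated, since membership in a cut is not decidable; the goal p < #solutions is.
round-up : ∀ (d : ℝ) → fromℕ 1 ≤ℝ d → ¬ ¬ (∃ λ D → 1 ≤ D × ¬ L d (ι D) × L d (ι D ℚ.* ½))
round-up d 1≤d none = search (suc ℤ.∣ ↥ q ∣) λ dN → ¬dq (ℝ.lower d (<-suc-numerator q) dN)
  where
  q = proj₁ (ℝ.proper d)
  ¬dq = proj₂ (ℝ.proper d)
  -- Descent from an upper bound `M` of d. If M - 1 lies below d, then so does M/2 ≤ M - 1 for M ≥
  -- 2, and `M` is a witness; for M = 1 the hypothesis 1 ≤ d supplies ½ < d, and M = 0 contradicts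
  -- it.
  search : ∀ M → ¬ L d (ι M) → ⊥
  search zero          ¬d0 = ¬d0 (1≤d 0ℚ (ι-mono-< {0} {1} (s≤s z≤n)))
  search (suc zero)    ¬d1 = none (1 , s≤s z≤n , ¬d1 , 1≤d (ι 1 ℚ.* ½) (ℚ.*<* (ℤ.+<+ (s≤s (s≤s z≤n)))))
  search (suc (suc M)) ¬d  = search (suc M) λ dM → none (suc (suc M) , s≤s z≤n , ¬d , L-lower d half≤ dM)
    where
    half≤ : ι (suc (suc M)) ℚ.* ½ ℚ.≤ ι (suc M)
    half≤ = begin
      ι (suc (suc M)) ℚ.* ½         ≤⟨ *-monoʳ-≤ (ℚ.nonNegative⁻¹ ½) (ι-mono-≤ {suc (suc M)} {suc M ℕ.* 2} (s≤s (s≤s (ℕ.m≤m*n M 2)))) ⟩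
      ι (suc M ℕ.* 2) ℚ.* ½         ≡⟨ cong (ℚ._* ½) (ι-* (suc M) 2) ⟩
      ι (suc M) ℚ.* ι 2 ℚ.* ½       ≡⟨ ℚ.*-assoc (ι (suc M)) (ι 2) ½ ⟩
      ι (suc M) ℚ.* 1ℚ              ≡⟨ ℚ.*-identityʳ _ ⟩
      ι (suc M)                     ∎
      where open ℚ.≤-Reasoning

½^*2^ : ∀ k → ½ ^ℚ k ℚ.* ι (2 ^ k) ≡ 1ℚ
½^*2^ k = trans (cong (½ ^ℚ k ℚ.*_) (ι-^ 2 k)) (trans (sym (^-distrib-* ½ (ι 2) k)) (one k))
  where
  one : ∀ k → 1ℚ ^ℚ k ≡ 1ℚ
  one zero    = refl
  one (suc k) = trans (ℚ.*-identityˡ _) (one k)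

0<½^ : ∀ k → 0ℚ ℚ.< ½ ^ℚ k
0<½^ zero    = ℚ.positive⁻¹ 1ℚ
0<½^ (suc k) = subst (ℚ._< ½ ^ℚ suc k) (ℚ.*-zeroʳ ½) (ℚ.*-monoʳ-<-pos ½ (0<½^ k))

½^-decreasing : ∀ k → ½ ^ℚ suc k ℚ.< ½ ^ℚ k
½^-decreasing k = subst (½ ^ℚ suc k ℚ.<_) (ℚ.*-identityˡ (½ ^ℚ k))
  (ℚ.*-monoˡ-<-pos (½ ^ℚ k) {{ℚ.positive (0<½^ k)}} {½} {1ℚ} (ℚ.*<* (ℤ.+<+ (s≤s (s≤s z≤n)))))

-- The shift by 2 makes both strict inequalities in the definition of 2 ^ℝ (-ℝ d) hold.
L-2^- : ∀ (d : ℝ) D → ¬ L d (ι D) → L (2 ^ℝ (-ℝ d)) (½ ^ℚ (2 ℕ.+ D))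
L-2^- d D ¬dD = fromℤ ℤ.-[1+ D ] , ½ ^ℚ suc D
  , (ℚ.- ι D , below D , subst (λ r → ¬ L d r) (sym (-‿involutive (ι D))) ¬dD)
  , ℚ.<⇒≤ (0<½^ (suc D))
  , ℚ.≤-reflexive (trans (cong₂ ℚ._*_ (ℚ.*-identityʳ (½ ^ℚ suc D)) (sym (ι-^ 2 (suc D)))) (½^*2^ (suc D)))
  , ½^-decreasing (suc D)
  where
  below : ∀ D → fromℤ ℤ.-[1+ D ] ℚ.< ℚ.- ι D
  below zero    = ℚ.*<* ℤ.-<+
  below (suc D) = fromℤ-mono-< (ℤ.-<- (ℕ.n<1+n D))

-- If `N` were larger, `a` would lie below 2^(-2 - D) times N/2, a member of the product cut, and
-- the hypothesis would give a < a. The third power of 2 comes from N/2 standing in for `N`, which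
-- is not in its own open cut.
dense-bound : ∀ (d : ℝ) D N a .{{_ : NonZero N}} → ¬ L d (ι D) →
              (2 ^ℝ (-ℝ d)) *ℝ fromℕ N ≤ℝ fromℕ a → N ≤ 2 ^ (3 ℕ.+ D) ℕ.* a
dense-bound d D N@(suc _) a ¬dD dense = ℕ.≮⇒≥ λ sparse →
  ℚ.<-irrefl refl (dense (ι a) (L-lower ((2 ^ℝ (-ℝ d)) *ℝ fromℕ N) (ℚ.<⇒≤ (begin-strict
    ι a                                                   ≡⟨ trans (cong (ℚ._* ι a) (½^*2^ k)) (ℚ.*-identityˡ (ι a)) ⟨
    ½ ^ℚ k ℚ.* ι (2 ^ k) ℚ.* ι a                          ≡⟨ trans (cong (½ ^ℚ k ℚ.*_) (ι-* (2 ^ k) a)) (sym (ℚ.*-assoc (½ ^ℚ k) (ι (2 ^ k)) (ι a))) ⟨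
    ½ ^ℚ k ℚ.* ι (2 ^ k ℕ.* a)                            <⟨ ℚ.*-monoʳ-<-pos (½ ^ℚ k) {{ℚ.positive (0<½^ k)}} (ι-mono-< sparse) ⟩
    ½ ^ℚ k ℚ.* ι N                                        ≡⟨ regroup ½ (½ ^ℚ (2 ℕ.+ D)) (ι N) ⟩
    ½ ^ℚ (2 ℕ.+ D) ℚ.* (½ ℚ.* ι N)                        ∎))
  (L-* (2 ^ℝ (-ℝ d)) (fromℕ N) (ℚ.<⇒≤ (0<½^ (2 ℕ.+ D))) (0≤* (ℚ.nonNegative⁻¹ ½) (0≤ι N)) (L-2^- d D ¬dD) half<)))
  where
  open ℚ.≤-Reasoning
  k = 3 ℕ.+ D
  regroup : ∀ h x n → h ℚ.* x ℚ.* n ≡ x ℚ.* (h ℚ.* n)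
  regroup = solve 3 (λ h x n → h :* x :* n := x :* (h :* n)) refl
    where open ℚSolver
  half< : ½ ℚ.* ι N ℚ.< ι N
  half< = subst (½ ℚ.* ι N ℚ.<_) (ℚ.*-identityˡ (ι N))
    (ℚ.*-monoˡ-<-pos (ι N) {{ℚ.positive (ι-mono-< {0} {N} (s≤s z≤n))}} {½} {1ℚ} (ℚ.*<* (ℤ.+<+ (s≤s (s≤s z≤n)))))

-- For t = -m/k the bound K < -t gives K k ≤ m, hence (s b^K)^k ≤ s^k b^m ≤ 1, whereas a number
-- above 1 has all its positive powers above 1.
RootBound-upper : ∀ b .{{_ : NonZero b}} K t {s} → ι K ℚ.< ℚ.- t → 0ℚ ℚ.≤ s →
                  RootBound b (↥ t) (↧ₙ t) s → s ℚ.* ι (b ^ K) ℚ.≤ 1ℚ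
RootBound-upper b K (ℚ.mkℚ (ℤ.+ zero) _ _) K<-t _ _ =
  contradiction (ℚ.≤-<-trans (0≤ι K) K<-t) λ { (ℚ.*<* (ℤ.+<+ ())) }
RootBound-upper b K (ℚ.mkℚ (ℤ.+ suc m) _ _) K<-t _ _ =
  contradiction (ℚ.≤-<-trans (0≤ι K) K<-t) λ { (ℚ.*<* ()) }
RootBound-upper b K (ℚ.mkℚ ℤ.-[1+ m ] k-1 _) {s} K<-t 0≤s root = ℚ.≮⇒≥ λ 1<y → ℚ.<-irrefl refl (begin-strict
  1ℚ                                       <⟨ 1<^ 1<y k-1 ⟩
  (s ℚ.* ι (b ^ K)) ^ℚ k                   ≡⟨ ^-distrib-* s (ι (b ^ K)) k ⟩
  s ^ℚ k ℚ.* ι (b ^ K) ^ℚ k                ≡⟨ cong (s ^ℚ k ℚ.*_) (ι-^ (b ^ K) k) ⟨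
  s ^ℚ k ℚ.* ι ((b ^ K) ^ k)               ≡⟨ cong (λ x → s ^ℚ k ℚ.* ι x) (ℕ.^-*-assoc b K k) ⟩
  s ^ℚ k ℚ.* ι (b ^ (K ℕ.* k))             ≤⟨ *-monoˡ-≤ (0≤^ 0≤s k) (ι-mono-≤ (ℕ.^-monoʳ-≤ b Kk≤m)) ⟩
  s ^ℚ k ℚ.* ι (b ^ suc m)                 ≡⟨ cong (s ^ℚ k ℚ.*_) (ι-^ b (suc m)) ⟩
  s ^ℚ k ℚ.* ι b ^ℚ suc m                  ≤⟨ root ⟩
  1ℚ                                       ∎)
  where
  open ℚ.≤-Reasoning
  k = suc k-1
  Kk≤m : K ℕ.* k ≤ suc m
  Kk≤m = ℕ.<⇒≤ (ℤ.drop‿+<+ (subst₂ ℤ._<_ (sym (ℤ.pos-* K k)) (ℤ.*-identityʳ (ℤ.+ suc m)) (ℚ.drop-*<* K<-t)))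

-- The exponent of many-solutions for E = 3 + D is 281 D + 1684 ≤ 1965 D, and the factor 1024
-- makes up for the ten halvings in d ^ⁿ 9 ≥ D / 2 ^ 10.
constant : ℕ
constant = suc (1024 ℕ.* 1965)

-- One factor of d^9 is bounded below by D/2, the other eight by ½, with one ½ more from `L-^`. The
-- successor in `constant` puts 1024 * 1965 strictly inside the open cut, and 2^10 then cancels
-- exactly.
L-exponent : ∀ (d : ℝ) D → L d ½ → L d (ι D ℚ.* ½) → L (fromℕ constant *ℝ d ^ⁿ 9) (ι (1965 ℕ.* D))
L-exponent d D d½ dD = subst (L (fromℕ constant *ℝ d ^ⁿ 9)) value
  (L-* (fromℕ constant) (d ^ⁿ 9) (0≤ι (1024 ℕ.* 1965)) (0≤* 0≤½D (0≤^ 0≤½ 9)) (ι-mono-< (ℕ.n<1+n (1024 ℕ.* 1965)))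
    (L-* d (d ^ⁿ 8) 0≤½D (0≤^ 0≤½ 9) dD (L-^ d d½ 8)))
  where
  0≤½ = ℚ.nonNegative⁻¹ ½
  0≤½D = 0≤* (0≤ι D) 0≤½
  regroup : ∀ a b d h x → a ℚ.* b ℚ.* (d ℚ.* h ℚ.* x) ≡ b ℚ.* d ℚ.* (a ℚ.* (h ℚ.* x))
  regroup = solve 5 (λ a b d h x → a :* b :* (d :* h :* x) := b :* d :* (a :* (h :* x))) refl
    where open ℚSolver
  value : ι (1024 ℕ.* 1965) ℚ.* (ι D ℚ.* ½ ℚ.* ½ ^ℚ 9) ≡ ι (1965 ℕ.* D)
  value = begin
    ι (1024 ℕ.* 1965) ℚ.* (ι D ℚ.* ½ ℚ.* ½ ^ℚ 9)          ≡⟨ cong (ℚ._* (ι D ℚ.* ½ ℚ.* ½ ^ℚ 9)) (ι-* 1024 1965) ⟩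
    ι 1024 ℚ.* ι 1965 ℚ.* (ι D ℚ.* ½ ℚ.* ½ ^ℚ 9)          ≡⟨ regroup (ι 1024) (ι 1965) (ι D) ½ (½ ^ℚ 9) ⟩
    ι 1965 ℚ.* ι D ℚ.* (ι 1024 ℚ.* (½ ℚ.* ½ ^ℚ 9))        ≡⟨ ℚ.*-identityʳ (ι 1965 ℚ.* ι D) ⟩
    ι 1965 ℚ.* ι D                                        ≡⟨ ι-* 1965 D ⟨
    ι (1965 ℕ.* D)                                        ∎
    where open ≡-Reasoning

-- A member `p` of the product cut lies below every corner of some box. When its first lower end `a`
-- is non-negative, the corner `a * c` suffices: a is below some r with r q^K ≤ 1, since K lies
-- below `x`, and c is at most N².
L-conclusion : ∀ q .{{_ : NonZero q}} (x : ℝ) K N s .{{_ : NonZero N}} → L x (ι K) → N ℕ.* N ≤ q ^ K ℕ.* s →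
               ∀ p → L ((q ^ℝ (-ℝ x)) *ℝ fromℕ N ^ⁿ 2) p → p ℚ.< ι s
L-conclusion q x K N@(suc _) s xK N²≤ p
  (a , _ , c , e , (t , r , (s′ , t<s′ , ¬x-s′) , 0≤r , root , a<r) , _ , N²c , ¬N²e , p<ac , p<ae , _)
  with ℚ.≤-total a 0ℚ
-- The box may reach below zero even though the power of q is positive. The corner with the upper
-- end `e`, which is non-negative, then shows that `p` is negative.
... | inj₁ a≤0 = begin-strict
  p             <⟨ p<ae ⟩
  a ℚ.* e       ≤⟨ *-monoʳ-≤ 0≤e a≤0 ⟩
  0ℚ ℚ.* e      ≡⟨ ℚ.*-zeroˡ e ⟩
  0ℚ            ≤⟨ 0≤ι s ⟩
  ι s           ∎
  where
  open ℚ.≤-Reasoning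
  0<N = ι-mono-< {0} {N} (s≤s z≤n)
  0≤0 = ℚ.≤-refl {0ℚ}
  0≤e : 0ℚ ℚ.≤ e
  0≤e = L-bound (fromℕ N ^ⁿ 2)
    (L-* (fromℕ N) (fromℕ N ^ⁿ 1) 0≤0 0≤0 0<N (L-* (fromℕ N) (fromℕ 1) 0≤0 0≤0 0<N (ι-mono-< {0} {1} (s≤s z≤n))))
    ¬N²e
... | inj₂ 0≤a = begin-strict
  p                                 <⟨ p<ac ⟩
  a ℚ.* c                           ≤⟨ *-monoˡ-≤ 0≤a c≤N² ⟩
  a ℚ.* ι (N ℕ.* N)                 ≤⟨ *-monoʳ-≤ (0≤ι (N ℕ.* N)) (ℚ.<⇒≤ a<r) ⟩
  r ℚ.* ι (N ℕ.* N)                 ≤⟨ *-monoˡ-≤ 0≤r (ι-mono-≤ N²≤) ⟩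
  r ℚ.* ι (q ^ K ℕ.* s)             ≡⟨ trans (cong (r ℚ.*_) (ι-* (q ^ K) s)) (sym (ℚ.*-assoc r (ι (q ^ K)) (ι s))) ⟩
  r ℚ.* ι (q ^ K) ℚ.* ι s           ≤⟨ *-monoʳ-≤ (0≤ι s) (RootBound-upper q K t K<-t 0≤r root) ⟩
  1ℚ ℚ.* ι s                        ≡⟨ ℚ.*-identityˡ (ι s) ⟩
  ι s                               ∎
  where
  open ℚ.≤-Reasoning
  K<-t : ι K ℚ.< ℚ.- t
  K<-t = ℚ.≤-<-trans (L-bound x xK ¬x-s′) (ℚ.neg-antimono-< t<s′)
  c≤N² : c ℚ.≤ ι (N ℕ.* N)
  c≤N² with L-fromℕ-* N (fromℕ N ^ⁿ 1) N²c
  ... | c₁ , Nc₁ , c<Nc₁ with L-fromℕ-* N (fromℕ 1) Nc₁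
  ... | c₂ , c₂<1 , c₁<Nc₂ = begin
    c                               ≤⟨ ℚ.<⇒≤ c<Nc₁ ⟩
    ι N ℚ.* c₁                      ≤⟨ *-monoˡ-≤ (0≤ι N) (ℚ.<⇒≤ c₁<Nc₂) ⟩
    ι N ℚ.* (ι N ℚ.* c₂)            ≤⟨ *-monoˡ-≤ (0≤ι N) (*-monoˡ-≤ (0≤ι N) (ℚ.<⇒≤ c₂<1)) ⟩
    ι N ℚ.* (ι N ℚ.* 1ℚ)            ≡⟨ cong (ι N ℚ.*_) (ℚ.*-identityʳ (ι N)) ⟩
    ι N ℚ.* ι N                     ≡⟨ ι-* N N ⟨
    ι (N ℕ.* N)                     ∎

-- The bound with an absolute constant

∣𝔽^∣≡ : ∀ 𝔽 n → ∣𝔽^_∣ 𝔽 n ≡ FiniteField.order 𝔽 ^ n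
∣𝔽^∣≡ 𝔽 n = trans (cong length (List.filter-all U? (All.universal-U (vectors 𝔽 n)))) (Supersaturation.length-vectors 𝔽 n)

theorem1p3 : Σ ℝ λ C → fromℕ 0 <ℝ C ×
    ((𝔽 : FiniteField) (n : ℕ) → 1 ≤ n →
    (d : ℝ) → fromℕ 1 ≤ℝ d →
    (A : Pred (Space 𝔽 n) 0ℓ) (A? : Decidable A) →
    let open FiniteField 𝔽 renaming (order to q) in
    (2 ^ℝ (-ℝ d)) *ℝ fromℕ (∣𝔽^_∣ 𝔽 n) ≤ℝ fromℕ (card 𝔽 A?) →
    (q ^ℝ (-ℝ (C *ℝ d ^ⁿ 9))) *ℝ fromℕ (∣𝔽^_∣ 𝔽 n) ^ⁿ 2 ≤ℝ fromℕ (#solutions 𝔽 A?))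
theorem1p3 = fromℕ constant , (0ℚ , ℚ.<-irrefl refl , ι-mono-< {0} {constant} (s≤s z≤n)) ,
  λ 𝔽 n _ d 1≤d A A? dense p Lp → decidable-stable (p ℚ.<? ι (#solutions 𝔽 A?)) λ p≮ →
    round-up d 1≤d λ (D , 1≤D , ¬dD , dD) → p≮ (conclude 𝔽 n d 1≤d A? dense D 1≤D ¬dD dD p Lp)
  where
  exponent≤ : ∀ {D} → 1 ≤ D → suc (3 ℕ.+ D) ℕ.+ 2 ℕ.* (140 ℕ.* (3 ℕ.+ (3 ℕ.+ D))) ≤ 1965 ℕ.* D
  exponent≤ {suc D} _ = ℕ.≤-trans (ℕ.m≤m+n _ (1684 ℕ.* D)) (ℕ.≤-reflexive (arith D))
    where
    arith : ∀ D → suc (3 ℕ.+ suc D) ℕ.+ 2 ℕ.* (140 ℕ.* (3 ℕ.+ (3 ℕ.+ suc D))) ℕ.+ 1684 ℕ.* D ≡ 1965 ℕ.* suc D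
    arith = ℕ.solve-∀

  conclude : ∀ 𝔽 n (d : ℝ) → fromℕ 1 ≤ℝ d → {A : Pred (Space 𝔽 n) 0ℓ} (A? : Decidable A) →
    (2 ^ℝ (-ℝ d)) *ℝ fromℕ (∣𝔽^_∣ 𝔽 n) ≤ℝ fromℕ (card 𝔽 A?) →
    ∀ D → 1 ≤ D → ¬ L d (ι D) → L d (ι D ℚ.* ½) → let open FiniteField 𝔽 in
    ∀ p → L ((order ^ℝ (-ℝ (fromℕ constant *ℝ d ^ⁿ 9))) *ℝ fromℕ (∣𝔽^_∣ 𝔽 n) ^ⁿ 2) p → p ℚ.< ι (#solutions 𝔽 A?)
  conclude 𝔽 n d 1≤d A? dense D 1≤D ¬dD dD =
    L-conclusion order (fromℕ constant *ℝ d ^ⁿ 9) (1965 ℕ.* D) N (#solutions 𝔽 A?) {{N≢0}}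
      (L-exponent d D (1≤d ½ (ℚ.*<* (ℤ.+<+ (s≤s (s≤s z≤n))))) dD) (begin
        N ℕ.* N                                    ≡⟨ cong₂ ℕ._*_ (∣𝔽^∣≡ 𝔽 n) (∣𝔽^∣≡ 𝔽 n) ⟩
        order ^ n ℕ.* order ^ n                    ≤⟨ Count.many-solutions 𝔽 A? (3 ℕ.+ D)
                                                        (subst (_≤ 2 ^ (3 ℕ.+ D) ℕ.* card 𝔽 A?) (∣𝔽^∣≡ 𝔽 n) (dense-bound d D N (card 𝔽 A?) {{N≢0}} ¬dD dense)) ⟩
        order ^ (suc (3 ℕ.+ D) ℕ.+ 2 ℕ.* (140 ℕ.* (3 ℕ.+ (3 ℕ.+ D)))) ℕ.* #solutions 𝔽 A?
                                                   ≤⟨ ℕ.*-monoˡ-≤ (#solutions 𝔽 A?) (ℕ.^-monoʳ-≤ order (exponent≤ 1≤D)) ⟩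
        order ^ (1965 ℕ.* D) ℕ.* #solutions 𝔽 A?   ∎)
    where
    open FiniteField 𝔽 using (order; order-nonZero)
    open ℕ.≤-Reasoning
    N = ∣𝔽^_∣ 𝔽 n
    N≢0 : NonZero N
    N≢0 = subst NonZero (sym (∣𝔽^∣≡ 𝔽 n)) (ℕ.m^n≢0 order n)
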